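{- If $q$ is a power of an odd prime, then \[ \triangle(q^6) \geq q^6 (q^3 - 1)(q + 1). \]
   Context: For a positive integer $k$, $\triangle(k)$ denotes the maximum number of triangles in a (finite, simple) 3-partite graph $G$ with $k$ vertices in each of its three parts such that, for any two of the three parts, the bipartite subgraph of $G$ formed by the edges between these two parts contains no cycle of length four. -}

module Defs where

open import Level using (0ℓ)
open import Data.Bool.Base using (Bool; true; false; T)
open import Data.Bool.Properties using (T?)
open import Data.Empty using (⊥; ⊥-elim)
open import Data.Fin.Base using (Fin)
open import Data.Fin.Patterns using (0F; 1F; 2F)
open import Data.Fin.Properties as Fin using (any?; all?)
open import Data.List.Base
  using (List; []; _∷_; length; filter; map; allFin; cartesianProduct; cartesianProductWith)
open import Data.List.Membership.Propositional using (_∈_)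
open import Data.List.Membership.Propositional.Properties
  using (∈-cartesianProductWith⁺; ∈-map⁺; ∈-filter⁺)
open import Data.List.Properties using (filter-≐)
open import Data.List.Relation.Unary.All using (lookup)
open import Data.List.Relation.Unary.All.Properties using (all-filter)
open import Data.List.Relation.Unary.Any using (here; there)
open import Data.Nat.Base using (ℕ; zero; suc; _^_; _≤_)
open import Data.Nat.Divisibility using (_∣_)
open import Data.Nat.Primality using (Prime)
open import Data.Nat.Properties using (≤-totalOrder)
open import Data.List.Extrema ≤-totalOrder
  using (argmax; argmax-all; f[xs]≤f[argmax])
open import Data.Product.Base using (∃; ∃-syntax; _×_; _,_; proj₁; proj₂; swap)
open import Data.Product.Properties using (≡-dec)
open import Data.Sum.Base using (_⊎_; inj₁; inj₂)
open import Data.Vec.Base as Vec using (Vec; tabulate)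
open import Data.Vec.Properties using (lookup∘tabulate)
open import Function.Base using (_∘_; id)
open import Relation.Binary.Core using (Rel)
open import Relation.Binary.Definitions using (DecidableEquality)
open import Relation.Binary.PropositionalEquality
  using (_≡_; _≢_; refl; sym; cong; subst)
open import Relation.Nullary using (¬_; Dec; no)
open import Relation.Nullary.Decidable
  using (map′; ¬?; _×-dec_; _⊎-dec_; _→-dec_; ⌊_⌋; toWitness; fromWitness)

record SimpleGraph (V : Set) : Set₁ where
  infix 4 _~_ _~?_
  field
    _~_         : Rel V 0ℓ
    _~?_        : ∀ u v → Dec (u ~ v)
    symmetric   : ∀ {u v} → u ~ v → v ~ u
    irreflexive : ∀ {v} → ¬ (v ~ v)

HasFourCycle : ∀ {V} → SimpleGraph V → Set
HasFourCycle G =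
  ∃[ a ] ∃[ b ] ∃[ c ] ∃[ d ]
    -- Consecutive vertices are distinct because there are no loops.
    (a ≢ c × b ≢ d × a ~ b × b ~ c × c ~ d × d ~ a)
  where open SimpleGraph G

Vertex : ℕ → Set
Vertex k = Fin 3 × Fin k

part : ∀ {k} → Vertex k → Fin 3
part = proj₁

Joins : ∀ {k} → Fin 3 → Fin 3 → Vertex k → Vertex k → Set
Joins i j u v = (part u ≡ i × part v ≡ j) ⊎ (part u ≡ j × part v ≡ i)

-- The vertices outside parts i and j are kept, as isolated vertices.
between : ∀ {k} → SimpleGraph (Vertex k) → Fin 3 → Fin 3 → SimpleGraph (Vertex k)
between G i j = record
  { _~_         = λ u v → u ~ v × Joins i j u v
  ; _~?_        = λ u v → (u ~? v) ×-dec
                    (((part u Fin.≟ i) ×-dec (part v Fin.≟ j)) ⊎-dec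
                     ((part u Fin.≟ j) ×-dec (part v Fin.≟ i)))
  ; symmetric   = λ { (e , inj₁ p) → symmetric e , inj₂ (swap p)
                    ; (e , inj₂ p) → symmetric e , inj₁ (swap p) }
  ; irreflexive = irreflexive ∘ proj₁
  }
  where open SimpleGraph G

IsTripartite : ∀ {k} → SimpleGraph (Vertex k) → Set
IsTripartite G = ∀ u v → u ~ v → part u ≢ part v
  where open SimpleGraph G

PairwiseC4Free : ∀ {k} → SimpleGraph (Vertex k) → Set
PairwiseC4Free G = ∀ i j → i ≢ j → ¬ HasFourCycle (between G i j)

Admissible : ∀ {k} → SimpleGraph (Vertex k) → Set
Admissible G = IsTripartite G × PairwiseC4Free G

-- A triangle of a 3-partite graph has exactly one vertex in each part, so
-- triangles correspond bijectively to the triples (x , y , z) below.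
IsTriangle : ∀ {k} → SimpleGraph (Vertex k) → Fin k × Fin k × Fin k → Set
IsTriangle G (x , y , z) = (0F , x) ~ (1F , y) × (1F , y) ~ (2F , z) × (0F , x) ~ (2F , z)
  where open SimpleGraph G

isTriangle? : ∀ {k} (G : SimpleGraph (Vertex k)) t → Dec (IsTriangle G t)
isTriangle? G (x , y , z) =
  ((0F , x) ~? (1F , y)) ×-dec ((1F , y) ~? (2F , z)) ×-dec ((0F , x) ~? (2F , z))
  where open SimpleGraph G

triangles : ∀ {k} → SimpleGraph (Vertex k) → ℕ
triangles {k} G =
  length (filter (isTriangle? G)
    (cartesianProduct (allFin k) (cartesianProduct (allFin k) (allFin k))))

record IsMaxTriangles (k m : ℕ) : Set₁ where
  field
    attained : ∃[ G ] (Admissible {k} G × triangles G ≡ m)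
    upper    : ∀ G → Admissible {k} G → triangles G ≤ m

------------------------------------------------------------------------
-- The maximum exists: up to equivalence of adjacency relations there are
-- finitely many graphs, and admissibility is decidable.

private

  infix 4 _≟ᵛ_
  _≟ᵛ_ : ∀ {k} → DecidableEquality (Vertex k)
  _≟ᵛ_ = ≡-dec Fin._≟_ Fin._≟_

  anyV? : ∀ {k} {P : Vertex k → Set} → (∀ v → Dec (P v)) → Dec (∃ P)
  anyV? P? = map′ (λ (i , x , p) → (i , x) , p) (λ ((i , x) , p) → i , x , p)
    (any? λ i → any? λ x → P? (i , x))

  allV? : ∀ {k} {P : Vertex k → Set} → (∀ v → Dec (P v)) → Dec (∀ v → P v)
  allV? P? = map′ (λ f (i , x) → f i x) (λ f i x → f (i , x))
    (all? λ i → all? λ x → P? (i , x))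

  hasFourCycle? : ∀ {k} (G : SimpleGraph (Vertex k)) → Dec (HasFourCycle G)
  hasFourCycle? G =
    anyV? λ a → anyV? λ b → anyV? λ c → anyV? λ d →
      ¬? (a ≟ᵛ c) ×-dec ¬? (b ≟ᵛ d) ×-dec
      (a ~? b) ×-dec (b ~? c) ×-dec (c ~? d) ×-dec (d ~? a)
    where open SimpleGraph G

  admissible? : ∀ {k} (G : SimpleGraph (Vertex k)) → Dec (Admissible G)
  admissible? G =
    (allV? λ u → allV? λ v → (u ~? v) →-dec ¬? (part u Fin.≟ part v)) ×-dec
    (all? λ i → all? λ j → ¬? (i Fin.≟ j) →-dec ¬? (hasFourCycle? (between G i j)))
    where open SimpleGraph G

  _⊆_ : ∀ {k} → SimpleGraph (Vertex k) → SimpleGraph (Vertex k) → Set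
  G ⊆ H = ∀ {u v} → SimpleGraph._~_ G u v → SimpleGraph._~_ H u v

  admissible-⊆ : ∀ {k} {G H : SimpleGraph (Vertex k)} → G ⊆ H → Admissible H → Admissible G
  admissible-⊆ G⊆H (tri , free) =
    (λ u v e → tri u v (G⊆H e)) ,
    (λ i j i≢j (a , b , c , d , a≢c , b≢d , (e₁ , p₁) , (e₂ , p₂) , (e₃ , p₃) , (e₄ , p₄)) →
      free i j i≢j (a , b , c , d , a≢c , b≢d ,
        (G⊆H e₁ , p₁) , (G⊆H e₂ , p₂) , (G⊆H e₃ , p₃) , (G⊆H e₄ , p₄)))

  triangles-≡ : ∀ {k} (G H : SimpleGraph (Vertex k)) → G ⊆ H → H ⊆ G → triangles G ≡ triangles H
  triangles-≡ {k} G H G⊆H H⊆G = cong length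
    (filter-≐ (isTriangle? G) (isTriangle? H)
      ((λ (p , q , r) → G⊆H p , G⊆H q , G⊆H r) , (λ (p , q , r) → H⊆G p , H⊆G q , H⊆G r))
      (cartesianProduct (allFin k) (cartesianProduct (allFin k) (allFin k))))

  vectors : ∀ {A : Set} → List A → ∀ n → List (Vec A n)
  vectors xs zero    = Vec.[] ∷ []
  vectors xs (suc n) = cartesianProductWith Vec._∷_ xs (vectors xs n)

  ∈-vectors : ∀ {A : Set} {xs : List A} → (∀ a → a ∈ xs) → ∀ {n} (v : Vec A n) → v ∈ vectors xs n
  ∈-vectors all∈ Vec.[]       = here refl
  ∈-vectors all∈ (a Vec.∷ as) = ∈-cartesianProductWith⁺ Vec._∷_ (all∈ a) (∈-vectors all∈ as)

  bools : List Bool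
  bools = false ∷ true ∷ []

  ∈-bools : ∀ b → b ∈ bools
  ∈-bools false = here refl
  ∈-bools true  = there (here refl)

  Table : ℕ → Set
  Table k = Vec (Vec (Vec (Vec Bool k) 3) k) 3

  tables : ∀ k → List (Table k)
  tables k = vectors (vectors (vectors (vectors bools k) 3) k) 3

  ∈-tables : ∀ {k} (t : Table k) → t ∈ tables k
  ∈-tables = ∈-vectors (∈-vectors (∈-vectors (∈-vectors ∈-bools)))

  entry : ∀ {k} → Table k → Vertex k → Vertex k → Bool
  entry t (i , x) (j , y) = Vec.lookup (Vec.lookup (Vec.lookup (Vec.lookup t i) x) j) y

  table : ∀ {k} → (Vertex k → Vertex k → Bool) → Table k
  table f = tabulate λ i → tabulate λ x → tabulate λ j → tabulate λ y → f (i , x) (j , y)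

  entry-table : ∀ {k} (f : Vertex k → Vertex k → Bool) u v → entry (table f) u v ≡ f u v
  entry-table f (i , x) (j , y)
    rewrite lookup∘tabulate (λ i → tabulate λ x → tabulate λ j → tabulate λ y → f (i , x) (j , y)) i
          | lookup∘tabulate (λ x → tabulate λ j → tabulate λ y → f (i , x) (j , y)) x
          | lookup∘tabulate (λ j → tabulate λ y → f (i , x) (j , y)) j
          = lookup∘tabulate (λ y → f (i , x) (j , y)) y

  fromTable : ∀ {k} → Table k → SimpleGraph (Vertex k)
  fromTable t = record
    { _~_         = λ u v → T (entry t u v) × T (entry t v u) × u ≢ v
    ; _~?_        = λ u v → T? (entry t u v) ×-dec T? (entry t v u) ×-dec ¬? (u ≟ᵛ v)
    ; symmetric   = λ (p , q , u≢v) → q , p , u≢v ∘ sym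
    ; irreflexive = λ (_ , _ , v≢v) → v≢v refl
    }

  module _ {k} (G : SimpleGraph (Vertex k)) where
    open SimpleGraph G

    toTable : Table k
    toTable = table (λ u v → ⌊ u ~? v ⌋)

    entry⁺ : ∀ {u v} → u ~ v → T (entry toTable u v)
    entry⁺ {u} {v} e =
      subst T (sym (entry-table (λ u v → ⌊ u ~? v ⌋) u v)) (fromWitness {a? = u ~? v} e)

    entry⁻ : ∀ {u v} → T (entry toTable u v) → u ~ v
    entry⁻ {u} {v} t =
      toWitness {a? = u ~? v} (subst T (entry-table (λ u v → ⌊ u ~? v ⌋) u v) t)

    from-⊆ : fromTable toTable ⊆ G
    from-⊆ (p , _) = entry⁻ p

    to-⊆ : G ⊆ fromTable toTable
    to-⊆ {u} e = entry⁺ e , entry⁺ (symmetric e) , λ u≡v → irreflexive (subst (u ~_) (sym u≡v) e)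

  emptyGraph : ∀ {k} → SimpleGraph (Vertex k)
  emptyGraph = record
    { _~_ = λ _ _ → ⊥ ; _~?_ = λ _ _ → no id ; symmetric = id ; irreflexive = id }

  emptyGraph-admissible : ∀ {k} → Admissible (emptyGraph {k})
  emptyGraph-admissible =
    (λ _ _ → ⊥-elim) , (λ { _ _ _ (_ , _ , _ , _ , _ , _ , (e , _) , _) → e })

maxTriangles : ∀ k → ∃ (IsMaxTriangles k)
maxTriangles k = triangles best , record
  { attained = best
             , argmax-all triangles {P = Admissible} {xs = candidates}
                 emptyGraph-admissible (all-filter admissible? (map fromTable (tables k)))
             , refl
  ; upper    = λ G adm → subst (_≤ triangles best)
      (triangles-≡ (fromTable (toTable G)) G (λ {_} {_} → from-⊆ G) (λ {_} {_} → to-⊆ G))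
      (lookup (f[xs]≤f[argmax] {f = triangles} emptyGraph candidates)
        (∈-filter⁺ admissible? (∈-map⁺ fromTable (∈-tables (toTable G)))
          (admissible-⊆ {G = fromTable (toTable G)} {H = G} (λ {_} {_} → from-⊆ G) adm)))
  }
  where
  candidates : List (SimpleGraph (Vertex k))
  candidates = filter admissible? (map fromTable (tables k))

  best : SimpleGraph (Vertex k)
  best = argmax triangles emptyGraph candidates

△ : ℕ → ℕ
△ k = proj₁ (maxTriangles k)

△-isMax : ∀ k → IsMaxTriangles k (△ k)
△-isMax k = proj₂ (maxTriangles k)

IsPowerOfOddPrime : ℕ → Set
IsPowerOfOddPrime q = ∃[ p ] ∃[ e ] (Prime p × ¬ (2 ∣ p) × 1 ≤ e × q ≡ p ^ e)

{-# OPTIONS --safe #-}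

-- Let F be the field of order q³, with φ a = a ^ q and N a = a · φ a. Every
-- part is a copy of F × F, and (v , w) in part i is joined to (v′ , w′) in
-- part j when w′ − w = κᵢⱼ N (v′ − v). A 4-cycle between two parts produces
-- nonzero x, y with x φy + y φx = 0; multiplying the three conjugates of
-- x φy = − y φx gives norm (xy) = − norm (xy), which is impossible as q is odd.
-- A triangle is a vertex (v , w) of part 0 with a zero (X , Y) of the form
-- α N X + β N Y + γ N (X + Y). The coefficients are chosen so that this form is
-- X′ φY′ − Y′ φX′ with X′ = X + c Y and Y′ = c X + d Y, which vanishes when
-- (X′ , Y′) is one of the (q³ − 1) (q + 1) nonzero multiples by F of a vector
-- over the fixed field of φ.
--
-- An extension of degree n of a field A of order q is a quotient of the group
-- algebra of ℤ/(qⁿ − 1) over A, in which a ^ (q ^ n) = a for every a. Hence it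
-- is reduced, and as the generator x satisfies ∏_{0<d<n} (x ^ (q ^ d) − x) ≠ 0
-- by comparing degrees, this product survives in some residue field. There x
-- has n distinct conjugates, so 1, x, …, x ^ (n − 1) are independent over A and
-- the residue field has qⁿ elements. F arises from ℤ/p in two such steps.
module Submission where

open import Defs
open import Level using (0ℓ)
open import Algebra.Bundles using (CommutativeRing)
import Algebra.Construct.Pointwise as Pointwise
import Algebra.Properties.Semiring.Exp as Exp
import Algebra.Properties.Semiring.Mult as Mult
import Algebra.Properties.Semiring.Sum as Sum
import Algebra.Solver.Ring
open import Algebra.Solver.Ring.AlmostCommutativeRing
  using (fromCommutativeRing; _-Raw-AlmostCommutative⟶_)
open import Data.Fin.Base
  using (Fin; zero; suc; toℕ; fromℕ; fromℕ<; inject₁; finToFun; funToFin; remQuot; combine; splitAt; join; punchIn)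
open import Data.Fin.Patterns using (0F; 1F; 2F)
import Data.Fin.Properties as Fin
open import Data.Integer.Base as ℤ using (ℤ; +_; -[1+_]; _⊖_)
import Data.Integer.Divisibility.Signed as ℤ∣
open import Data.Integer.DivMod using (_%ℕ_; _/ℕ_; n%ℕd<d; a≡a%ℕn+[a/ℕn]*n)
import Data.Integer.Properties as ℤ
open import Data.Integer.Solver using (module +-*-Solver)
open import Data.List.Base using (List; length; lookup)
open import Data.List.Membership.Propositional using (_∈_)
open import Data.List.Membership.Propositional.Properties using (∈-filter⁺; ∈-cartesianProduct⁺; ∈-allFin)
open import Data.List.Relation.Unary.Any using (index)
open import Data.List.Relation.Unary.Any.Properties using (lookup-index)
open import Data.Maybe.Base using (Maybe; just; nothing)
open import Data.Nat.Base as ℕ using (ℕ; zero; suc; _∸_; _≤_; _<_; z≤n; s≤s)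
open import Data.Nat.Combinatorics using (_C_; nC1≡n; nCn≡1; nCk+nC[k+1]≡[n+1]C[k+1])
open import Data.Nat.Divisibility using (_∣_; divides; ∣⇒≤; >⇒∤; ∣1⇒≡1; m%n≡0⇒n∣m)
open import Data.Nat.DivMod using (_%_; _/_; m≡m%n+[m/n]*n; m%n<n)
open import Data.Nat.Primality using (Prime; prime[2]; prime⇒nonTrivial; prime⇒nonZero; euclidsLemma)
import Data.Nat.Properties as ℕ
open import Data.Product.Base using (∃; _×_; _,_; proj₁; proj₂; uncurry)
open import Data.Sum.Base using (_⊎_; inj₁; inj₂; [_,_]′)
open import Function.Base using (_∘_)
open import Function.Definitions using (Injective)
open import Relation.Binary.Definitions using (Decidable; tri<; tri≈; tri>)
open import Relation.Binary.PropositionalEquality as ≡ using (_≡_; _≢_)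
open import Relation.Binary.Structures using (IsEquivalence)
open import Relation.Nullary using (¬_; yes; no; contradiction)
open import Relation.Nullary.Decidable using (map′; ¬?; _×-dec_)

-- A ring solver with integer coefficients.

-- With coefficients in ℤ instead of R, the solver recognises cancellations.
module IntegerCoefficientSolver (R : CommutativeRing 0ℓ 0ℓ) where
  open CommutativeRing R hiding (zero)
  open import Algebra.Properties.Ring ring
  open import Algebra.Properties.Semiring.Mult semiring using (×-homo-+; ×1-homo-*) renaming (_×_ to _·_)
  open import Relation.Binary.Reasoning.Setoid setoid

  fromℤ : ℤ → Carrier
  fromℤ (+ n)      = n · 1#
  fromℤ (-[1+ n ]) = - (suc n · 1#)

  x+y-[x+z] : ∀ x y z → (x + y) - (x + z) ≈ y - z
  x+y-[x+z] x y z = begin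
    (x + y) - (x + z)     ≈⟨ +-cong (+-comm y x) (-‿+-comm x z) ⟨
    (y + x) + (- x - z)   ≈⟨ +-assoc y x _ ⟩
    y + (x + (- x - z))   ≈⟨ +-congˡ (+-assoc x (- x) (- z)) ⟨
    y + (x - x - z)       ≈⟨ +-congˡ (+-congʳ (-‿inverseʳ x)) ⟩
    y + (0# - z)          ≈⟨ +-congˡ (+-identityˡ _) ⟩
    y - z                 ∎

  ⊖-homo : ∀ m n → fromℤ (m ⊖ n) ≈ m · 1# - n · 1#
  ⊖-homo m       zero    = sym (trans (+-congˡ -0#≈0#) (+-identityʳ _))
  ⊖-homo zero    (suc n) = sym (+-identityˡ _)
  ⊖-homo (suc m) (suc n) = begin
    fromℤ (suc m ⊖ suc n)           ≡⟨ ≡.cong fromℤ (ℤ.[1+m]⊖[1+n]≡m⊖n m n) ⟩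
    fromℤ (m ⊖ n)                   ≈⟨ ⊖-homo m n ⟩
    m · 1# - n · 1#                 ≈⟨ x+y-[x+z] 1# _ _ ⟨
    (1# + m · 1#) - (1# + n · 1#)   ∎

  +-homo : ∀ i j → fromℤ (i ℤ.+ j) ≈ fromℤ i + fromℤ j
  +-homo (+ m)      (+ n)      = ×-homo-+ 1# m n
  +-homo (+ m)      (-[1+ n ]) = ⊖-homo m (suc n)
  +-homo (-[1+ m ]) (+ n)      = trans (⊖-homo n (suc m)) (+-comm _ _)
  +-homo (-[1+ m ]) (-[1+ n ]) = begin
    - (suc (suc (m ℕ.+ n)) · 1#)    ≡⟨ ≡.cong (λ k → - (suc k · 1#)) (ℕ.+-suc m n) ⟨
    - ((suc m ℕ.+ suc n) · 1#)      ≈⟨ -‿cong (×-homo-+ 1# (suc m) (suc n)) ⟩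
    - (suc m · 1# + suc n · 1#)     ≈⟨ -‿+-comm _ _ ⟨
    - (suc m · 1#) - (suc n · 1#)   ∎

  -‿homo : ∀ i → fromℤ (ℤ.- i) ≈ - fromℤ i
  -‿homo (+ zero)   = sym -0#≈0#
  -‿homo (+ suc n)  = refl
  -‿homo (-[1+ n ]) = sym (-‿involutive _)

  -homo⁺ : ∀ m j → fromℤ (+ m ℤ.* j) ≈ m · 1# * fromℤ j
  -homo⁺ m (+ n)      = begin
    fromℤ (+ m ℤ.* + n)   ≡⟨ ≡.cong fromℤ (ℤ.pos-* m n) ⟨
    (m ℕ.* n) · 1#        ≈⟨ ×1-homo-* m n ⟩
    m · 1# * (n · 1#)     ∎
  -homo⁺ m (-[1+ n ]) = begin
    fromℤ (+ m ℤ.* -[1+ n ])        ≡⟨ ≡.cong fromℤ (ℤ.neg-distribʳ-* (+ m) (+ suc n)) ⟨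
    fromℤ (ℤ.- (+ m ℤ.* + suc n))   ≈⟨ -‿homo (+ m ℤ.* + suc n) ⟩
    - fromℤ (+ m ℤ.* + suc n)       ≈⟨ -‿cong (-homo⁺ m (+ suc n)) ⟩
    - (m · 1# * (suc n · 1#))       ≈⟨ -‿distribʳ-* _ _ ⟩
    m · 1# * - (suc n · 1#)         ∎

  *-homo : ∀ i j → fromℤ (i ℤ.* j) ≈ fromℤ i * fromℤ j
  *-homo (+ m)      j = -homo⁺ m j
  *-homo (-[1+ m ]) j = begin
    fromℤ (-[1+ m ] ℤ.* j)        ≡⟨ ≡.cong fromℤ (ℤ.neg-distribˡ-* (+ suc m) j) ⟨
    fromℤ (ℤ.- (+ suc m ℤ.* j))   ≈⟨ -‿homo (+ suc m ℤ.* j) ⟩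
    - fromℤ (+ suc m ℤ.* j)       ≈⟨ -‿cong (-homo⁺ (suc m) j) ⟩
    - (suc m · 1# * fromℤ j)      ≈⟨ -‿distribˡ-* _ _ ⟩
    - (suc m · 1#) * fromℤ j      ∎

  morphism : ℤ.+-*-rawRing -Raw-AlmostCommutative⟶ fromCommutativeRing R
  morphism = record
    { ⟦_⟧    = fromℤ
    ; +-homo = +-homo
    ; *-homo = *-homo
    ; -‿homo = -‿homo
    ; 0-homo = refl
    ; 1-homo = +-identityʳ 1#
    }

  weaklyEqual : ∀ i j → Maybe (fromℤ i ≈ fromℤ j)
  weaklyEqual i j with i ℤ.≟ j
  ... | yes ≡.refl = just refl
  ... | no _       = nothing

  open Algebra.Solver.Ring ℤ.+-*-rawRing (fromCommutativeRing R) morphism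
    weaklyEqual public
    using (solve; _:=_; _:+_; _:*_; _:-_; :-_; con)

-- Binomial coefficients modulo a prime, and additivity of the Frobenius map.

-- Induction on `n`: Pascal's rule splits the left side, and one row up it recombines the two
-- induction hypotheses.
absorption : ∀ n k → suc k ℕ.* (suc n C suc k) ≡ suc n ℕ.* (n C k)
absorption n zero = begin
  1 ℕ.* (suc n C 1)    ≡⟨ ℕ.*-identityˡ _ ⟩
  suc n C 1            ≡⟨ nC1≡n (suc n) ⟩
  suc n                ≡⟨ ℕ.*-identityʳ (suc n) ⟨
  suc n ℕ.* (n C 0)    ∎
  where open ≡.≡-Reasoning
absorption zero (suc k) = ℕ.*-zeroʳ (suc (suc k))
absorption (suc n) (suc k) = begin
  suc (suc k) ℕ.* (suc (suc n) C suc (suc k))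
    ≡⟨ ≡.cong (suc (suc k) ℕ.*_) (nCk+nC[k+1]≡[n+1]C[k+1] (suc n) (suc k)) ⟨
  suc (suc k) ℕ.* (a ℕ.+ (suc n C suc (suc k)))
    ≡⟨ ℕ.*-distribˡ-+ (suc (suc k)) a _ ⟩
  a ℕ.+ suc k ℕ.* a ℕ.+ suc (suc k) ℕ.* (suc n C suc (suc k))
    ≡⟨ ≡.cong₂ (λ x y → a ℕ.+ x ℕ.+ y) (absorption n k) (absorption n (suc k)) ⟩
  a ℕ.+ suc n ℕ.* (n C k) ℕ.+ suc n ℕ.* (n C suc k)
    ≡⟨ ℕ.+-assoc a _ _ ⟩
  a ℕ.+ (suc n ℕ.* (n C k) ℕ.+ suc n ℕ.* (n C suc k))
    ≡⟨ ≡.cong (a ℕ.+_) (ℕ.*-distribˡ-+ (suc n) (n C k) (n C suc k)) ⟨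
  a ℕ.+ suc n ℕ.* ((n C k) ℕ.+ (n C suc k))
    ≡⟨ ≡.cong (λ x → a ℕ.+ suc n ℕ.* x) (nCk+nC[k+1]≡[n+1]C[k+1] n k) ⟩
  suc (suc n) ℕ.* a ∎
  where
  open ≡.≡-Reasoning
  a = suc n C suc k

-- By `absorption`, p divides k times `p C k`, and it cannot divide k, which is positive and smaller
-- than p.
prime∣binomial : ∀ {p} → Prime p → ∀ k → 0 < k → k < p → p ∣ p C k
prime∣binomial {suc p} isPrime (suc k) _ k<p
  with euclidsLemma (suc k) (suc p C suc k) isPrime
         (divides (p C k) (≡.trans (absorption p k) (ℕ.*-comm (suc p) (p C k))))
... | inj₁ p∣k = contradiction (∣⇒≤ p∣k) (ℕ.<⇒≱ k<p)
... | inj₂ p∣C = p∣C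

module Frobenius (R : CommutativeRing 0ℓ 0ℓ) {p : ℕ} (isPrime : Prime p) where
  open CommutativeRing R hiding (zero)
  open import Algebra.Properties.CommutativeSemiring.Binomial commutativeSemiring
    using (binomialTerm; theorem)
  open import Algebra.Properties.CommutativeSemiring.Exp commutativeSemiring
  open import Algebra.Properties.Semiring.Mult semiring renaming (_×_ to _·_)
  open import Algebra.Properties.Semiring.Sum semiring
  open import Relation.Binary.Reasoning.Setoid setoid
  open import Data.Fin.Properties using (toℕ<n; toℕ-fromℕ; toℕ-inject₁)
  open import Data.Fin.Base using (inject₁)

  module _ (p·1≈0 : p · 1# ≈ 0#) where

    p∣n⇒n·x≈0 : ∀ {n} x → p ∣ n → n · x ≈ 0#
    p∣n⇒n·x≈0 x (divides c ≡.refl) = begin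
      (c ℕ.* p) · x          ≈⟨ ×-congˡ (ℕ.*-comm c p) ⟩
      (p ℕ.* c) · x          ≈⟨ ×-assocˡ x p c ⟨
      p · (c · x)            ≈⟨ ×-congʳ p (*-identityˡ _) ⟨
      p · (1# * (c · x))     ≈⟨ ×-assoc-* p 1# _ ⟨
      (p · 1#) * (c · x)     ≈⟨ *-congʳ p·1≈0 ⟩
      0# * (c · x)           ≈⟨ zeroˡ _ ⟩
      0#                     ∎

    ^p-homo-+ : ∀ x y → (x + y) ^ p ≈ x ^ p + y ^ p
    ^p-homo-+ x y = ends p ≡.refl
      where
      -- The exponent is generalised so that it can be matched as a successor, which separates the
      -- first and last binomial terms from the middle ones.
      ends : ∀ n → n ≡ p → (x + y) ^ n ≈ x ^ n + y ^ n
      ends zero 0≡p = contradiction (≡.sym 0≡p) (ℕ.≢-nonZero⁻¹ p {{prime⇒nonZero isPrime}})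
      ends (suc n) ≡.refl = begin
        (x + y) ^ suc n                                     ≈⟨ theorem (suc n) x y ⟩
        t zero + sum (λ i → t (suc i))                      ≈⟨ +-congˡ (sum-init-last (λ i → t (suc i))) ⟩
        t zero + (sum (λ i → t (suc (inject₁ i))) + t (suc (fromℕ n)))
          ≈⟨ +-cong first (+-cong (trans (sum-cong-≋ middle) (sum-replicate-zero n)) last) ⟩
        y ^ suc n + (0# + x ^ suc n)                        ≈⟨ +-congˡ (+-identityˡ _) ⟩
        y ^ suc n + x ^ suc n                               ≈⟨ +-comm _ _ ⟩
        x ^ suc n + y ^ suc n                               ∎
        where
        t = binomialTerm x y (suc n)

        first : t zero ≈ y ^ suc n
        first = trans (+-identityʳ _) (*-identityˡ _)

        last : t (suc (fromℕ n)) ≈ x ^ suc n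
        last rewrite toℕ-fromℕ n | nCn≡1 (suc n) | ℕ.n∸n≡0 n =
          trans (+-identityʳ _) (*-identityʳ _)

        middle : ∀ i → t (suc (inject₁ i)) ≈ 0#
        middle i = p∣n⇒n·x≈0 _ (prime∣binomial isPrime _ (s≤s z≤n)
          (s≤s (≡.subst (_< n) (≡.sym (toℕ-inject₁ i)) (toℕ<n i))))

    ^pᵉ-homo-+ : ∀ e x y → (x + y) ^ (p ℕ.^ e) ≈ x ^ (p ℕ.^ e) + y ^ (p ℕ.^ e)
    ^pᵉ-homo-+ zero    x y = trans (*-identityʳ _) (sym (+-cong (*-identityʳ _) (*-identityʳ _)))
    ^pᵉ-homo-+ (suc e) x y = begin
      (x + y) ^ (p ℕ.* q)               ≈⟨ ^-assocʳ _ p q ⟨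
      ((x + y) ^ p) ^ q                 ≈⟨ ^-congˡ q (^p-homo-+ x y) ⟩
      (x ^ p + y ^ p) ^ q               ≈⟨ ^pᵉ-homo-+ e _ _ ⟩
      (x ^ p) ^ q + (y ^ p) ^ q         ≈⟨ +-cong (^-assocʳ x p q) (^-assocʳ y p q) ⟩
      x ^ (p ℕ.* q) + y ^ (p ℕ.* q)     ∎
      where q = p ℕ.^ e

-- Cyclic shifts and the group algebra of a cyclic group.

module CyclicShift (m : ℕ) where

  predᶜ : Fin (suc m) → Fin (suc m)
  predᶜ zero    = fromℕ m
  predᶜ (suc k) = inject₁ k

  -- Subtraction of `j` modulo `suc m`, as an iteration, so that composing shifts is a plain
  -- recursion.
  shift : ℕ → Fin (suc m) → Fin (suc m)
  shift zero    k = k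
  shift (suc j) k = shift j (predᶜ k)

  shift-+ : ∀ i j k → shift (i ℕ.+ j) k ≡ shift j (shift i k)
  shift-+ zero    j k = ≡.refl
  shift-+ (suc i) j k = shift-+ i j (predᶜ k)

  shift-comm : ∀ i j k → shift i (shift j k) ≡ shift j (shift i k)
  shift-comm i j k = begin
    shift i (shift j k)    ≡⟨ shift-+ j i k ⟨
    shift (j ℕ.+ i) k      ≡⟨ ≡.cong (λ n → shift n k) (ℕ.+-comm j i) ⟩
    shift (i ℕ.+ j) k      ≡⟨ shift-+ i j k ⟩
    shift j (shift i k)    ∎
    where open ≡.≡-Reasoning

  toℕ-shift : ∀ j k → j ≤ toℕ k → toℕ (shift j k) ≡ toℕ k ∸ j
  toℕ-shift zero    k       _         = ≡.refl
  toℕ-shift (suc j) (suc k) (s≤s j≤k) = ≡.trans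
    (toℕ-shift j (inject₁ k) (≡.subst (j ≤_) (≡.sym (Fin.toℕ-inject₁ k)) j≤k))
    (≡.cong (_∸ j) (Fin.toℕ-inject₁ k))

  shift-toℕ : ∀ k → shift (toℕ k) k ≡ zero
  shift-toℕ k = Fin.toℕ-injective (≡.trans (toℕ-shift (toℕ k) k ℕ.≤-refl) (ℕ.n∸n≡0 (toℕ k)))

  -- The first step wraps around from 0 to m; the other `j` steps descend without wrapping.
  toℕ-shift-zero : ∀ j → j ≤ m → toℕ (shift (suc j) zero) ≡ m ∸ j
  toℕ-shift-zero j j≤m = ≡.trans
    (toℕ-shift j (fromℕ m) (≡.subst (j ≤_) (≡.sym (Fin.toℕ-fromℕ m)) j≤m))
    (≡.cong (_∸ j) (Fin.toℕ-fromℕ m))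

  -- A full turn descends k steps to 0, wraps to m, and descends m - k further steps to k.
  shift-full : ∀ k → shift (suc m) k ≡ k
  shift-full k = Fin.toℕ-injective (begin
    toℕ (shift (suc m) k)                             ≡⟨ ≡.cong (λ n → toℕ (shift n k)) split ⟨
    toℕ (shift (toℕ k ℕ.+ suc (m ∸ toℕ k)) k)         ≡⟨ ≡.cong toℕ (shift-+ (toℕ k) _ k) ⟩
    toℕ (shift (suc (m ∸ toℕ k)) (shift (toℕ k) k))   ≡⟨ ≡.cong (toℕ ∘ shift (suc (m ∸ toℕ k))) (shift-toℕ k) ⟩
    toℕ (shift (suc (m ∸ toℕ k)) zero)                ≡⟨ toℕ-shift-zero (m ∸ toℕ k) (ℕ.m∸n≤m m (toℕ k)) ⟩
    m ∸ (m ∸ toℕ k)                                   ≡⟨ ℕ.m∸[m∸n]≡n k≤m ⟩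
    toℕ k                                             ∎)
    where
    open ≡.≡-Reasoning
    k≤m : toℕ k ≤ m
    k≤m = ℕ.≤-pred (Fin.toℕ<n k)
    split : toℕ k ℕ.+ suc (m ∸ toℕ k) ≡ suc m
    split = ≡.trans (ℕ.+-suc (toℕ k) _) (≡.cong suc (ℕ.m+[n∸m]≡n k≤m))

  -- If i ≤ k, nothing wraps and the value is k - i. Otherwise 0 is reached after k steps, and the
  -- remaining `suc j` steps end at m - j, which is positive.
  shift≡zero⇒≡ : ∀ (i k : Fin (suc m)) → shift (toℕ i) k ≡ zero → i ≡ k
  shift≡zero⇒≡ i k eq with toℕ i ℕ.≤? toℕ k
  ... | yes i≤k = Fin.toℕ-injective (ℕ.≤-antisym i≤k
          (ℕ.m∸n≡0⇒m≤n (≡.trans (≡.sym (toℕ-shift (toℕ i) k i≤k)) (≡.cong toℕ eq))))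
  ... | no  i≰k = contradiction (≡.trans (≡.sym (toℕ-shift-zero j j≤m)) (≡.cong toℕ below)) (ℕ.m>n⇒m∸n≢0 j<m)
    where
    j = toℕ i ∸ suc (toℕ k)
    split : toℕ k ℕ.+ suc j ≡ toℕ i
    split = ≡.trans (ℕ.+-suc (toℕ k) j) (ℕ.m+[n∸m]≡n (ℕ.≰⇒> i≰k))
    j<m : j < m
    j<m = ℕ.≤-trans (ℕ.≤-trans (ℕ.m≤n+m (suc j) (toℕ k)) (ℕ.≤-reflexive split)) (ℕ.≤-pred (Fin.toℕ<n i))
    j≤m = ℕ.<⇒≤ j<m
    below : shift (suc j) zero ≡ zero
    below = begin
      shift (suc j) zero                  ≡⟨ ≡.cong (shift (suc j)) (shift-toℕ k) ⟨
      shift (suc j) (shift (toℕ k) k)     ≡⟨ shift-+ (toℕ k) (suc j) k ⟨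
      shift (toℕ k ℕ.+ suc j) k           ≡⟨ ≡.cong (λ n → shift n k) split ⟩
      shift (toℕ i) k                     ≡⟨ eq ⟩
      zero                                ∎
      where open ≡.≡-Reasoning

-- The group algebra of the cyclic group of order suc m.
module GroupAlgebra (A : CommutativeRing 0ℓ 0ℓ) (m : ℕ) where
  open CyclicShift m public
  private module A = CommutativeRing A
  open A using (_≈_; _+_; _*_; 0#; 1#)
  open import Algebra.Properties.Semiring.Sum A.semiring
    using (sum; sum-cong-≋; sum-replicate-zero; *-distribˡ-sum; ∑-comm; ∑-distrib-+)
  open import Algebra.Properties.Semiring.Mult A.semiring using () renaming (_×_ to _·ᴬ_)
  open import Relation.Binary.Reasoning.Setoid A.setoid

  Element : Set
  Element = Fin (suc m) → A.Carrier

  infix 4 _≋_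
  _≋_ : Element → Element → Set
  a ≋ b = ∀ k → a k ≈ b k

  sum-zero : ∀ {n} {f : Fin n → A.Carrier} → (∀ i → f i ≈ 0#) → sum f ≈ 0#
  sum-zero {n} f≈0 = A.trans (sum-cong-≋ f≈0) (sum-replicate-zero n)

  sum-single : ∀ {n} (f : Fin n → A.Carrier) k → (∀ i → i ≢ k → f i ≈ 0#) → sum f ≈ f k
  sum-single f zero    h = A.trans (A.+-congˡ (sum-zero λ i → h (suc i) λ ())) (A.+-identityʳ _)
  sum-single f (suc k) h = A.trans
    (A.+-cong (h zero λ ()) (sum-single (f ∘ suc) k λ i i≢k → h (suc i) (i≢k ∘ Fin.suc-injective)))
    (A.+-identityˡ _)

  -- Abstract, so that the summand can be inferred from a sum.
  abstract
    Σ : Element → A.Carrier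
    Σ = sum

    Σ≡sum : ∀ f → Σ f ≡ sum f
    Σ≡sum f = ≡.refl

    Σ-cong : ∀ {f g : Element} → f ≋ g → Σ f ≈ Σ g
    Σ-cong = sum-cong-≋

    *-distribˡ-Σ : ∀ c f → c * Σ f ≈ Σ λ i → c * f i
    *-distribˡ-Σ = *-distribˡ-sum

    Σ-comm : ∀ (f : Fin (suc m) → Element) → Σ (λ i → Σ λ j → f i j) ≈ Σ (λ j → Σ λ i → f i j)
    Σ-comm = ∑-comm

    Σ-distrib-+ : ∀ f g → Σ (λ i → f i + g i) ≈ Σ f + Σ g
    Σ-distrib-+ = ∑-distrib-+

    Σ-single : ∀ f k → (∀ i → i ≢ k → f i ≈ 0#) → Σ f ≈ f k
    Σ-single = sum-single

  infixl 7 _⊛_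
  -- Cyclic convolution: an element a stands for the sum of a k times the k-th power of a group
  -- generator.
  _⊛_ : Element → Element → Element
  (a ⊛ b) k = Σ λ i → (a i * b (shift (toℕ i) k))

  δ : Element
  δ zero    = 1#
  δ (suc _) = 0#

  δ≉0⇒zero : ∀ k → k ≢ zero → δ k ≈ 0#
  δ≉0⇒zero zero    k≢0 = contradiction ≡.refl k≢0
  δ≉0⇒zero (suc k) _   = A.refl

  ⊛-cong : ∀ {a a′ b b′} → a ≋ a′ → b ≋ b′ → a ⊛ b ≋ a′ ⊛ b′
  ⊛-cong a≋a′ b≋b′ k = Σ-cong λ i → A.*-cong (a≋a′ i) (b≋b′ _)

  ⊛-identityˡ : ∀ a → δ ⊛ a ≋ a
  ⊛-identityˡ a k = A.trans (Σ-single _ zero λ { zero 0≢0 → contradiction ≡.refl 0≢0 ; (suc i) _ → A.zeroˡ _ })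
                            (A.*-identityˡ _)

  ⊛-identityʳ : ∀ a → a ⊛ δ ≋ a
  ⊛-identityʳ a k = begin
    (a ⊛ δ) k                      ≈⟨ Σ-single _ k off-diagonal ⟩
    a k * δ (shift (toℕ k) k)      ≡⟨ ≡.cong (λ j → a k * δ j) (shift-toℕ k) ⟩
    a k * 1#                       ≈⟨ A.*-identityʳ _ ⟩
    a k                            ∎
    where
    off-diagonal : ∀ i → i ≢ k → a i * δ (shift (toℕ i) k) ≈ 0#
    off-diagonal i i≢k = A.trans (A.*-congˡ (δ≉0⇒zero _ (i≢k ∘ shift≡zero⇒≡ i k))) (A.zeroʳ _)

  -- Exchanging the two sums suffices, as shifts commute. This form avoids reindexing a cyclic sum:
  -- commutativity is the case where `c` is the unit, and associativity follows from both.
  ⊛-leftComm : ∀ a b c → a ⊛ (b ⊛ c) ≋ b ⊛ (a ⊛ c)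
  ⊛-leftComm a b c k = begin
    (Σ λ i → (a i * Σ λ j → (b j * c (shift (toℕ j) (shift (toℕ i) k)))))
      ≈⟨ Σ-cong (λ i → *-distribˡ-Σ (a i) _) ⟩
    (Σ λ i → Σ λ j → (a i * (b j * c (shift (toℕ j) (shift (toℕ i) k)))))
      ≈⟨ Σ-comm (λ i j → a i * (b j * c (shift (toℕ j) (shift (toℕ i) k)))) ⟩
    (Σ λ j → Σ λ i → (a i * (b j * c (shift (toℕ j) (shift (toℕ i) k)))))
      ≈⟨ Σ-cong (λ j → Σ-cong (λ i → swap (a i) (b j) (shift-comm (toℕ j) (toℕ i) k))) ⟩
    (Σ λ j → Σ λ i → (b j * (a i * c (shift (toℕ i) (shift (toℕ j) k)))))
      ≈⟨ Σ-cong (λ j → *-distribˡ-Σ (b j) (λ i → a i * c (shift (toℕ i) (shift (toℕ j) k)))) ⟨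
    (Σ λ j → (b j * Σ λ i → (a i * c (shift (toℕ i) (shift (toℕ j) k)))))
      ∎
    where
    swap : ∀ x y {i j} → i ≡ j → x * (y * c i) ≈ y * (x * c j)
    swap x y ≡.refl = A.trans (A.sym (A.*-assoc x y _)) (A.trans (A.*-congʳ (A.*-comm x y)) (A.*-assoc y x _))

  ≋-trans : ∀ {a b c} → a ≋ b → b ≋ c → a ≋ c
  ≋-trans p q k = A.trans (p k) (q k)

  ≋-sym : ∀ {a b} → a ≋ b → b ≋ a
  ≋-sym p k = A.sym (p k)

  ⊛-congˡ : ∀ a {b c} → b ≋ c → a ⊛ b ≋ a ⊛ c
  ⊛-congˡ a b≋c = ⊛-cong {a} {a} (λ _ → A.refl) b≋c

  ⊛-comm : ∀ a b → a ⊛ b ≋ b ⊛ a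
  ⊛-comm a b = ≋-trans (⊛-congˡ a (≋-sym (⊛-identityʳ b)))
              (≋-trans (⊛-leftComm a b δ) (⊛-congˡ b (⊛-identityʳ a)))

  ⊛-assoc : ∀ a b c → (a ⊛ b) ⊛ c ≋ a ⊛ (b ⊛ c)
  ⊛-assoc a b c = ≋-trans (⊛-comm (a ⊛ b) c)
                 (≋-trans (⊛-leftComm c a b) (⊛-congˡ a (⊛-comm c b)))

  ⊛-distribˡ : ∀ a b c → a ⊛ (λ k → b k + c k) ≋ (λ k → (a ⊛ b) k + (a ⊛ c) k)
  ⊛-distribˡ a b c k = A.trans (Σ-cong λ i → A.distribˡ _ _ _)
    (Σ-distrib-+ (λ i → a i * b (shift (toℕ i) k)) (λ i → a i * c (shift (toℕ i) k)))

  ⊛-distribʳ : ∀ a b c → (λ k → b k + c k) ⊛ a ≋ (λ k → (b ⊛ a) k + (c ⊛ a) k)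
  ⊛-distribʳ a b c k = A.trans (Σ-cong λ i → A.distribʳ _ _ _)
    (Σ-distrib-+ (λ i → b i * a (shift (toℕ i) k)) (λ i → c i * a (shift (toℕ i) k)))

  algebra : CommutativeRing 0ℓ 0ℓ
  algebra = record
    { Carrier = Element
    ; _≈_     = _≋_
    ; _*_     = _⊛_
    ; 1#      = δ
    ; isCommutativeRing = record
      { isRing = record
        { +-isAbelianGroup = Pointwise.isAbelianGroup (Fin (suc m)) A.+-isAbelianGroup
        ; *-cong           = ⊛-cong
        ; *-assoc          = ⊛-assoc
        ; *-identity       = ⊛-identityˡ , ⊛-identityʳ
        ; distrib          = ⊛-distribˡ , ⊛-distribʳ
        }
      ; *-comm = ⊛-comm
      }
    }

  open CommutativeRing algebra public using ()
    renaming (semiring to R-semiring)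
  open import Algebra.Properties.Semiring.Exp R-semiring using (_^_)
  open import Algebra.Properties.Semiring.Mult R-semiring using () renaming (_×_ to _·_)

  -- The delta function at 1 modulo `suc m`.
  generator : Element
  generator k = δ (predᶜ k)

  -- With the factors swapped, `predᶜ` moves past the shift in each summand, and the sum becomes
  -- `v ⊛ δ` at `predᶜ k`.
  generator-⊛ : ∀ v k → (generator ⊛ v) k ≈ v (predᶜ k)
  generator-⊛ v k = A.trans (⊛-comm generator v k) (A.trans
    (Σ-cong λ i → A.*-congˡ (A.reflexive (≡.cong δ (shift-comm 1 (toℕ i) k))))
    (⊛-identityʳ v (predᶜ k)))

  generator^-⊛ : ∀ j v k → (generator ^ j ⊛ v) k ≈ v (shift j k)
  generator^-⊛ zero    v k = ⊛-identityˡ v k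
  generator^-⊛ (suc j) v k = A.trans (⊛-assoc generator (generator ^ j) v k)
    (A.trans (generator-⊛ (generator ^ j ⊛ v) k) (generator^-⊛ j v (predᶜ k)))

  generator^-lookup : ∀ j k → (generator ^ j) k ≈ δ (shift j k)
  generator^-lookup j k = A.trans (A.sym (⊛-identityʳ (generator ^ j) k)) (generator^-⊛ j δ k)

  constant : A.Carrier → Element
  constant c k = c * δ k

  constant-⊛ : ∀ c v k → (constant c ⊛ v) k ≈ c * v k
  constant-⊛ c v k = begin
    (Σ λ i → (c * δ i * v (shift (toℕ i) k))) ≈⟨ Σ-cong (λ i → A.*-assoc c (δ i) _) ⟩
    (Σ λ i → (c * (δ i * v (shift (toℕ i) k)))) ≈⟨ *-distribˡ-Σ c _ ⟨
    c * (δ ⊛ v) k                                       ≈⟨ A.*-congˡ (⊛-identityˡ v k) ⟩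
    c * v k                                             ∎

  constant-cong : ∀ {c d} → c ≈ d → constant c ≋ constant d
  constant-cong c≈d k = A.*-congʳ c≈d

  constant-1 : constant 1# ≋ δ
  constant-1 k = A.*-identityˡ _

  constant-* : ∀ c d → constant (c * d) ≋ constant c ⊛ constant d
  constant-* c d k = A.trans (A.*-assoc c d _) (A.sym (constant-⊛ c (constant d) k))

  ·-lookup : ∀ n v k → (n · v) k ≈ n ·ᴬ v k
  ·-lookup zero    v k = A.refl
  ·-lookup (suc n) v k = A.+-congˡ (·-lookup n v k)

  -- This is `a ⊛ δ` read termwise, a shifted unit being a power of the generator. It reduces the
  -- power identity to constants and powers of `generator`.
  expansion : ∀ a → a ≋ λ k → Σ λ i → (constant (a i) ⊛ generator ^ toℕ i) k
  expansion a k = begin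
    a k                                                   ≈⟨ ⊛-identityʳ a k ⟨
    (Σ λ i → (a i * δ (shift (toℕ i) k))) ≈⟨ Σ-cong (λ i → A.*-congˡ (generator^-lookup (toℕ i) k)) ⟨
    (Σ λ i → (a i * (generator ^ toℕ i) k)) ≈⟨ Σ-cong (λ i → constant-⊛ (a i) (generator ^ toℕ i) k) ⟨
    (Σ λ i → (constant (a i) ⊛ generator ^ toℕ i) k) ∎

-- Quotient rings and annihilators.

record Congruence (R : CommutativeRing 0ℓ 0ℓ) : Set₁ where
  open CommutativeRing R
  field
    _∼_             : Carrier → Carrier → Set
    ∼-isEquivalence : IsEquivalence _∼_
    lift            : ∀ {a b} → a ≈ b → a ∼ b
    +-cong∼         : ∀ {a a′ b b′} → a ∼ a′ → b ∼ b′ → (a + b) ∼ (a′ + b′)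
    *-cong∼         : ∀ {a a′ b b′} → a ∼ a′ → b ∼ b′ → (a * b) ∼ (a′ * b′)
    -‿cong∼         : ∀ {a a′} → a ∼ a′ → (- a) ∼ (- a′)

-- Only the equality becomes coarser. Carrier and operations stay the same, so every ring law lifts
-- and elements need no transport.
module Quotient (R : CommutativeRing 0ℓ 0ℓ) (C : Congruence R) where
  open CommutativeRing R hiding (zero)
  open Congruence C

  quotient : CommutativeRing 0ℓ 0ℓ
  quotient = record
    { Carrier = Carrier
    ; _≈_     = _∼_
    ; _+_     = _+_
    ; _*_     = _*_
    ; -_      = -_
    ; 0#      = 0#
    ; 1#      = 1#
    ; isCommutativeRing = record
      { isRing = record
        { +-isAbelianGroup = record
          { isGroup = record
            { isMonoid = record
              { isSemigroup = record
                { isMagma = record { isEquivalence = ∼-isEquivalence ; ∙-cong = +-cong∼ }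
                ; assoc   = λ a b c → lift (+-assoc a b c)
                }
              ; identity = (λ a → lift (+-identityˡ a)) , (λ a → lift (+-identityʳ a))
              }
            ; inverse = (λ a → lift (-‿inverseˡ a)) , (λ a → lift (-‿inverseʳ a))
            ; ⁻¹-cong = -‿cong∼
            }
          ; comm = λ a b → lift (+-comm a b)
          }
        ; *-cong     = *-cong∼
        ; *-assoc    = λ a b c → lift (*-assoc a b c)
        ; *-identity = (λ a → lift (*-identityˡ a)) , (λ a → lift (*-identityʳ a))
        ; distrib    = (λ a b c → lift (distribˡ a b c)) , (λ a b c → lift (distribʳ a b c))
        }
      ; *-comm = λ a b → lift (*-comm a b)
      }
    }

  open Exp semiring using (_^_)
  open Mult semiring using () renaming (_×_ to _·_)
  open Exp (CommutativeRing.semiring quotient) using () renaming (_^_ to _^∼_)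
  open Mult (CommutativeRing.semiring quotient) using () renaming (_×_ to _·∼_)

  ^∼≡^ : ∀ a k → a ^∼ k ≡ a ^ k
  ^∼≡^ a zero    = ≡.refl
  ^∼≡^ a (suc k) = ≡.cong (a *_) (^∼≡^ a k)

  ·∼≡· : ∀ k a → k ·∼ a ≡ k · a
  ·∼≡· zero    a = ≡.refl
  ·∼≡· (suc k) a = ≡.cong (λ b → a + b) (·∼≡· k a)

  lift-^ : ∀ {a b} k → a ^ k ≈ b → (a ^∼ k) ∼ b
  lift-^ {a} {b} k eq = ≡.subst (_∼ b) (≡.sym (^∼≡^ a k)) (lift eq)

  lift-· : ∀ {a b} k → k · a ≈ b → (k ·∼ a) ∼ b
  lift-· {a} {b} k eq = ≡.subst (_∼ b) (≡.sym (·∼≡· k a)) (lift eq)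

module AnnihilatorQuotient (R : CommutativeRing 0ℓ 0ℓ) (e : CommutativeRing.Carrier R) where
  open CommutativeRing R
  open import Algebra.Properties.Ring ring using (-‿distribʳ-*)
  open import Relation.Binary.Reasoning.Setoid setoid

  infix 4 _≈ₑ_
  -- Equality modulo the annihilator of `e`; the quotient is a copy of the ideal generated by `e`.
  _≈ₑ_ : Carrier → Carrier → Set
  a ≈ₑ b = e * a ≈ e * b

  *-congₑ : ∀ {a a′ b b′} → a ≈ₑ a′ → b ≈ₑ b′ → a * b ≈ₑ a′ * b′
  *-congₑ {a} {a′} {b} {b′} a≈a′ b≈b′ = begin
    e * (a * b)     ≈⟨ *-assoc e a b ⟨
    e * a * b       ≈⟨ *-congʳ a≈a′ ⟩
    e * a′ * b      ≈⟨ *-congʳ (*-comm e a′) ⟩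
    a′ * e * b      ≈⟨ *-assoc a′ e b ⟩
    a′ * (e * b)    ≈⟨ *-congˡ b≈b′ ⟩
    a′ * (e * b′)   ≈⟨ *-assoc a′ e b′ ⟨
    a′ * e * b′     ≈⟨ *-congʳ (*-comm a′ e) ⟩
    e * a′ * b′     ≈⟨ *-assoc e a′ b′ ⟩
    e * (a′ * b′)   ∎

  congruence : Congruence R
  congruence = record
    { _∼_             = _≈ₑ_
    ; ∼-isEquivalence = record { refl = refl ; sym = sym ; trans = trans }
    ; lift            = *-congˡ
    ; +-cong∼         = λ p q → trans (distribˡ e _ _) (trans (+-cong p q) (sym (distribˡ e _ _)))
    ; *-cong∼         = *-congₑ
    ; -‿cong∼         = λ p → trans (sym (-‿distribʳ-* e _)) (trans (-‿cong p) (-‿distribʳ-* e _))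
    }

  open Congruence congruence public using (lift)
  open Quotient R congruence public

-- Residue fields of rings with a power identity.

PowerIdentity : CommutativeRing 0ℓ 0ℓ → ℕ → Set
PowerIdentity R n = ∀ a → a ^ n ≈ a
  where
  open CommutativeRing R
  open Exp semiring using (_^_)

-- In a ring with a ^ (2 + t) ≈ a, every a is a unit times the idempotent
-- a ^ (1 + t); shrinking e by such idempotents makes the quotient a field.
module MaximalAnnihilator
  (R : CommutativeRing 0ℓ 0ℓ) (_≟_ : Decidable (CommutativeRing._≈_ R))
  (t : ℕ) (a^[2+t]≈a : PowerIdentity R (2 ℕ.+ t))
  where
  open CommutativeRing R hiding (zero)
  open Exp semiring using (_^_)
  open import Relation.Binary.Reasoning.Setoid setoid

  -- Modulo the annihilator of `e`, the element `a` is zero or invertible.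
  ZeroOrUnit : Carrier → Carrier → Set
  ZeroOrUnit e a = e * a ≈ 0# ⊎ ∃ λ b → e * (a * b) ≈ e

  scale : ∀ {e x} s → e * x ≈ 0# → (e * s) * x ≈ 0#
  scale {e} {x} s ex≈0 = begin
    e * s * x      ≈⟨ *-congʳ (*-comm e s) ⟩
    s * e * x      ≈⟨ *-assoc s e x ⟩
    s * (e * x)    ≈⟨ *-congˡ ex≈0 ⟩
    s * 0#         ≈⟨ zeroʳ s ⟩
    0#             ∎

  -- The annihilator only grows from `e` to `e * s`, so the alternative already reached persists in
  -- the smaller quotient.
  zeroOrUnit-* : ∀ {e a} s → ZeroOrUnit e a → ZeroOrUnit (e * s) a
  zeroOrUnit-* s (inj₁ ea≈0) = inj₁ (scale s ea≈0)
  zeroOrUnit-* {e} {a} s (inj₂ (b , eab≈e)) = inj₂ (b , (begin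
    e * s * (a * b)      ≈⟨ *-congʳ (*-comm e s) ⟩
    s * e * (a * b)      ≈⟨ *-assoc s e _ ⟩
    s * (e * (a * b))    ≈⟨ *-congˡ eab≈e ⟩
    s * e                ≈⟨ *-comm s e ⟩
    e * s                ∎))

  zeroOrUnit-cong : ∀ {e a a′} → a ≈ a′ → ZeroOrUnit e a → ZeroOrUnit e a′
  zeroOrUnit-cong a≈a′ (inj₁ ea≈0)        = inj₁ (trans (*-congˡ (sym a≈a′)) ea≈0)
  zeroOrUnit-cong a≈a′ (inj₂ (b , eab≈e)) = inj₂ (b , trans (*-congˡ (*-congʳ (sym a≈a′))) eab≈e)

  -- In other words a ^ (1 + t) is idempotent: modulo its annihilator, `a ^ t` inverts `a`.
  power-absorbs : ∀ a → a ^ suc t * (a * a ^ t) ≈ a ^ suc t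
  power-absorbs a = begin
    a ^ suc t * (a * a ^ t)     ≈⟨ *-assoc (a ^ suc t) a (a ^ t) ⟨
    a ^ suc t * a * a ^ t       ≈⟨ *-congʳ (*-comm (a ^ suc t) a) ⟩
    a ^ (2 ℕ.+ t) * a ^ t       ≈⟨ *-congʳ (a^[2+t]≈a a) ⟩
    a ^ suc t                   ∎

  -- The new multiplier is nonzero because multiplying it by `a` gives back `e * a`.
  power-unit : ∀ e a → ¬ e * a ≈ 0# → ¬ e * a ^ suc t ≈ 0# × ZeroOrUnit (e * a ^ suc t) a
  power-unit e a ea≉0 =
    (λ eaᵗ≈0 → ea≉0 (begin
      e * a                     ≈⟨ *-congˡ (a^[2+t]≈a a) ⟨
      e * (a * a ^ suc t)       ≈⟨ *-congˡ (*-comm a _) ⟩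
      e * (a ^ suc t * a)       ≈⟨ *-assoc e _ a ⟨
      e * a ^ suc t * a         ≈⟨ *-congʳ eaᵗ≈0 ⟩
      0# * a                    ≈⟨ zeroˡ a ⟩
      0#                        ∎)) ,
    inj₂ (a ^ t , trans (*-assoc e _ _) (*-congˡ (power-absorbs a)))

  -- The enumerated elements are treated one at a time. An element already annihilated leaves `s`
  -- alone; any other one contributes its idempotent, which does not disturb the elements settled
  -- before.
  refine : ∀ {T} (enum : Fin T → Carrier) e → ¬ e ≈ 0# →
           ∃ λ s → ¬ e * s ≈ 0# × ∀ i → ZeroOrUnit (e * s) (enum i)
  refine {zero}  enum e e≉0 = 1# , e≉0 ∘ trans (sym (*-identityʳ e)) , λ ()
  refine {suc T} enum e e≉0 with refine (enum ∘ suc) e e≉0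
  ... | s , es≉0 , h with (e * s * enum zero) ≟ 0#
  ...   | yes ea≈0 = s , es≉0 , λ { zero → inj₁ ea≈0 ; (suc i) → h i }
  ...   | no  ea≉0 = s * u , proj₁ pu ∘ trans (*-assoc e s u) ,
      λ { zero → reassoc (proj₂ pu) ; (suc i) → reassoc (zeroOrUnit-* u (h i)) }
    where
    u = enum zero ^ suc t
    pu = power-unit (e * s) (enum zero) ea≉0
    reassoc : ∀ {a} → ZeroOrUnit (e * s * u) a → ZeroOrUnit (e * (s * u)) a
    reassoc (inj₁ p)       = inj₁ (trans (*-congʳ (sym (*-assoc e s u))) p)
    reassoc (inj₂ (b , p)) = inj₂ (b , trans (*-congʳ (sym (*-assoc e s u))) (trans p (*-assoc e s u)))

  reduced : ∀ e → e * e ≈ 0# → e ≈ 0#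
  reduced e ee≈0 = begin
    e                     ≈⟨ a^[2+t]≈a e ⟨
    e * (e * e ^ t)       ≈⟨ *-assoc e e _ ⟨
    e * e * e ^ t         ≈⟨ *-congʳ ee≈0 ⟩
    0# * e ^ t            ≈⟨ zeroˡ _ ⟩
    0#                    ∎

  maximalAnnihilator : ∀ {T} (enum : Fin T → Carrier) → (∀ a → ∃ λ i → enum i ≈ a) →
                       ∀ θ → ¬ θ ≈ 0# →
                       ∃ λ e → ¬ e ≈ 0# × ¬ e * θ ≈ 0# × ∀ a → ZeroOrUnit e a
  maximalAnnihilator enum complete θ θ≉0 with refine enum θ θ≉0
  -- Refinement starts from θ, so e is a multiple of θ. Hence e θ = 0 would give e e = 0, and the
  -- ring is reduced.
  ... | s , e≉0 , h = θ * s , e≉0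
      , (λ eθ≈0 → e≉0 (reduced (θ * s) (begin
          θ * s * (θ * s)    ≈⟨ *-assoc (θ * s) θ s ⟨
          θ * s * θ * s      ≈⟨ *-congʳ eθ≈0 ⟩
          0# * s             ≈⟨ zeroˡ s ⟩
          0#                 ∎)))
      , λ a → zeroOrUnit-cong (proj₂ (complete a)) (h (proj₁ (complete a)))

-- Polynomials over a field and their roots.

record IsField (R : CommutativeRing 0ℓ 0ℓ) : Set where
  open CommutativeRing R
  field
    _≟_     : Decidable _≈_
    1≉0     : ¬ 1# ≈ 0#
    inverse : ∀ a → ¬ a ≈ 0# → ∃ λ b → a * b ≈ 1#

module FieldProperties (R : CommutativeRing 0ℓ 0ℓ) (isField : IsField R) where
  open CommutativeRing R hiding (zero)
  open IsField isField
  open import Algebra.Properties.Ring ring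
  open import Algebra.Properties.Semiring.Exp semiring
  open import Relation.Binary.Reasoning.Setoid setoid
  open IntegerCoefficientSolver R

  x-y≈0⇒x≈y : ∀ {x y} → x - y ≈ 0# → x ≈ y
  x-y≈0⇒x≈y {x} {y} = x∙y⁻¹≈ε⇒x≈y x y

  x≈y⇒x-y≈0 : ∀ {x y} → x ≈ y → x - y ≈ 0#
  x≈y⇒x-y≈0 x≈y = trans (+-congʳ x≈y) (-‿inverseʳ _)

  *-cancelˡ-≉0 : ∀ {a x y} → ¬ a ≈ 0# → a * x ≈ a * y → x ≈ y
  *-cancelˡ-≉0 {a} {x} {y} a≉0 ax≈ay with inverse a a≉0
  ... | b , ab≈1 = trans (sym (undo x)) (trans (*-congˡ ax≈ay) (undo y))
    where
    undo : ∀ z → b * (a * z) ≈ z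
    undo z = begin
      b * (a * z)    ≈⟨ *-assoc b a z ⟨
      b * a * z      ≈⟨ *-congʳ (trans (*-comm b a) ab≈1) ⟩
      1# * z         ≈⟨ *-identityˡ z ⟩
      z              ∎

  x*y≈0⇒y≈0 : ∀ {x y} → ¬ x ≈ 0# → x * y ≈ 0# → y ≈ 0#
  x*y≈0⇒y≈0 x≉0 xy≈0 = *-cancelˡ-≉0 x≉0 (trans xy≈0 (sym (zeroʳ _)))

  x*y≈0⇒x≈0∨y≈0 : ∀ {x y} → x * y ≈ 0# → x ≈ 0# ⊎ y ≈ 0#
  x*y≈0⇒x≈0∨y≈0 {x} xy≈0 with x ≟ 0#
  ... | yes x≈0 = inj₁ x≈0
  ... | no  x≉0 = inj₂ (x*y≈0⇒y≈0 x≉0 xy≈0)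

  *-≉0 : ∀ {x y} → ¬ x ≈ 0# → ¬ y ≈ 0# → ¬ x * y ≈ 0#
  *-≉0 x≉0 y≉0 = y≉0 ∘ x*y≈0⇒y≈0 x≉0

  1^n≈1 : ∀ n → 1# ^ n ≈ 1#
  1^n≈1 zero    = refl
  1^n≈1 (suc n) = trans (*-identityˡ _) (1^n≈1 n)

  eval : ∀ {n} → (Fin n → Carrier) → Carrier → Carrier
  eval {zero}  f y = 0#
  eval {suc n} f y = f zero + y * eval (f ∘ suc) y

  eval-zero : ∀ {n} {f : Fin n → Carrier} → (∀ i → f i ≈ 0#) → ∀ y → eval f y ≈ 0#
  eval-zero {zero}  f≈0 y = refl
  eval-zero {suc n} f≈0 y = trans (+-cong (f≈0 zero) (trans (*-congˡ (eval-zero (f≈0 ∘ suc) y)) (zeroʳ y))) (+-identityʳ 0#)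

  eval-- : ∀ {n} (f g : Fin n → Carrier) y → eval (λ i → f i - g i) y ≈ eval f y - eval g y
  eval-- {zero}  f g y = sym (-‿inverseʳ 0#)
  eval-- {suc n} f g y = trans (+-congˡ (*-congˡ (eval-- (f ∘ suc) (g ∘ suc) y)))
    (solve 5 (λ a b y u v → (a :- b) :+ y :* (u :- v) := (a :+ y :* u) :- (b :+ y :* v)) refl _ _ _ _ _)

  -- X f(X) − r f(r) = (X − r) (quotientAt f r)(X).
  quotientAt : ∀ {n} → (Fin n → Carrier) → Carrier → Fin n → Carrier
  quotientAt f r zero    = eval f r
  quotientAt f r (suc i) = quotientAt (f ∘ suc) r i

  eval-quotientAt : ∀ {n} (f : Fin n → Carrier) r y →
                    y * eval f y - r * eval f r ≈ (y - r) * eval (quotientAt f r) y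
  eval-quotientAt {zero}  f r y =
    solve 3 (λ y r z → y :* con (+ 0) :- r :* con (+ 0) := (y :- r) :* con (+ 0)) refl y r 0#
  eval-quotientAt {suc n} f r y = begin
    y * (c + y * u) - r * (c + r * v)
      ≈⟨ solve 5 (λ c y r u v → y :* (c :+ y :* u) :- r :* (c :+ r :* v)
                  := (y :- r) :* (c :+ r :* v) :+ y :* (y :* u :- r :* v)) refl c y r u v ⟩
    (y - r) * (c + r * v) + y * (y * u - r * v)
      ≈⟨ +-congˡ (*-congˡ (eval-quotientAt (f ∘ suc) r y)) ⟩
    (y - r) * (c + r * v) + y * ((y - r) * w)
      ≈⟨ solve 4 (λ y r d w → (y :- r) :* d :+ y :* ((y :- r) :* w) := (y :- r) :* (d :+ y :* w)) refl y r (c + r * v) w ⟩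
    (y - r) * (c + r * v + y * w) ∎
    where
    c = f zero
    u = eval (f ∘ suc) y
    v = eval (f ∘ suc) r
    w = eval (quotientAt (f ∘ suc) r) y

  -- The passage from f to its quotient is triangular: entry i is f i plus r times a value of the
  -- later coefficients, which vanish first.
  quotientAt-zero : ∀ {n} (f : Fin n → Carrier) r → (∀ i → quotientAt f r i ≈ 0#) → ∀ i → f i ≈ 0#
  quotientAt-zero f r h (suc i) = quotientAt-zero (f ∘ suc) r (h ∘ suc) i
  quotientAt-zero f r h zero    = begin
    f zero                              ≈⟨ +-identityʳ _ ⟨
    f zero + 0#                         ≈⟨ +-congˡ (zeroʳ r) ⟨
    f zero + r * 0#                     ≈⟨ +-congˡ (*-congˡ (eval-zero (quotientAt-zero (f ∘ suc) r (h ∘ suc)) r)) ⟨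
    f zero + r * eval (f ∘ suc) r       ≈⟨ h zero ⟩
    0#                                  ∎

  -- Induction: with h the tail of f, f(X) - f(r) = X h(X) - r h(r) = (X - r) g(X). The other roots
  -- of f are therefore roots of g, which has one coefficient fewer.
  root-bound : ∀ {n} (f : Fin n → Carrier) (ρ : Fin n → Carrier) →
               (∀ {i j} → ρ i ≈ ρ j → i ≡ j) → (∀ i → eval f (ρ i) ≈ 0#) → ∀ i → f i ≈ 0#
  root-bound {suc n} f ρ ρ-injective roots = all-zero
    where
    r = ρ zero
    g = quotientAt (f ∘ suc) r

    g-roots : ∀ i → eval g (ρ (suc i)) ≈ 0#
    g-roots i = x*y≈0⇒y≈0 (λ y-r≈0 → contradiction (ρ-injective (x-y≈0⇒x≈y y-r≈0)) λ ()) (begin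
      (y - r) * eval g y                                          ≈⟨ eval-quotientAt (f ∘ suc) r y ⟨
      y * eval (f ∘ suc) y - r * eval (f ∘ suc) r                 ≈⟨ solve 3 (λ c u v → u :- v := (c :+ u) :- (c :+ v)) refl (f zero) _ _ ⟩
      eval f y - eval f r                                         ≈⟨ x≈y⇒x-y≈0 (trans (roots (suc i)) (sym (roots zero))) ⟩
      0#                                                          ∎)
      where y = ρ (suc i)

    tail-zero : ∀ i → f (suc i) ≈ 0#
    tail-zero = quotientAt-zero (f ∘ suc) r
      (root-bound g (ρ ∘ suc) (Fin.suc-injective ∘ ρ-injective) g-roots)

    all-zero : ∀ i → f i ≈ 0#
    all-zero (suc i) = tail-zero i
    all-zero zero    = begin
      f zero                           ≈⟨ +-identityʳ _ ⟨
      f zero + 0#                      ≈⟨ +-congˡ (zeroʳ r) ⟨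
      f zero + r * 0#                  ≈⟨ +-congˡ (*-congˡ (eval-zero tail-zero r)) ⟨
      f zero + r * eval (f ∘ suc) r    ≈⟨ roots zero ⟩
      0#                               ∎

  monomial : ∀ t → Fin (suc t) → Carrier
  monomial zero    zero    = 1#
  monomial (suc t) zero    = 0#
  monomial (suc t) (suc i) = monomial t i

  eval-monomial : ∀ t y → eval (monomial t) y ≈ y ^ t
  eval-monomial zero    y = trans (+-congˡ (zeroʳ y)) (+-identityʳ 1#)
  eval-monomial (suc t) y = trans (+-identityˡ _) (*-congˡ (eval-monomial t y))

  X^[2+t]-X : ∀ t → Fin (3 ℕ.+ t) → Carrier
  X^[2+t]-X t zero          = 0#
  X^[2+t]-X t (suc zero)    = - 1#
  X^[2+t]-X t (suc (suc i)) = monomial t i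

  eval-X^[2+t]-X : ∀ t y → eval (X^[2+t]-X t) y ≈ y ^ (2 ℕ.+ t) - y
  eval-X^[2+t]-X t y = trans (+-congˡ (*-congˡ (+-congˡ (*-congˡ (eval-monomial t y)))))
    (trans (solve 3 (λ y z u → con (+ 0) :+ y :* (:- u :+ y :* z) := y :* (y :* z) :- y :* u) refl y (y ^ t) 1#)
      (+-congˡ (-‿cong (*-identityʳ y))))

  -- By `root-bound` all coefficients of X ^ (2 + t) - X would vanish. Those from index 2 on are the
  -- coefficients of X ^ t, whose value at 1 is 1.
  few-fixed-points : ∀ t (ρ : Fin (3 ℕ.+ t) → Carrier) → (∀ {i j} → ρ i ≈ ρ j → i ≡ j) →
                     ¬ (∀ i → ρ i ^ (2 ℕ.+ t) ≈ ρ i)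
  few-fixed-points t ρ ρ-injective fixed = 1≉0 (begin
    1#                        ≈⟨ 1^n≈1 t ⟨
    1# ^ t                    ≈⟨ eval-monomial t 1# ⟨
    eval (monomial t) 1#      ≈⟨ eval-zero (λ i → zeros (suc (suc i))) 1# ⟩
    0#                        ∎)
    where
    zeros : ∀ i → X^[2+t]-X t i ≈ 0#
    zeros = root-bound (X^[2+t]-X t) ρ ρ-injective
      (λ i → trans (eval-X^[2+t]-X t (ρ i)) (x≈y⇒x-y≈0 (fixed i)))

-- Finite fields, their extensions, and algebras with enough conjugates.

record FiniteField (p q : ℕ) : Set₁ where
  field
    commutativeRing : CommutativeRing 0ℓ 0ℓ
    isField         : IsField commutativeRing
  open CommutativeRing commutativeRing public hiding (zero)
  open IsField isField public
  open Exp semiring using (_^_)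
  open Mult semiring using () renaming (_×_ to _·_)
  field
    characteristic     : p · 1# ≈ 0#
    exponent           : ∃ λ e → q ≡ p ℕ.^ suc e
    ^q-identity        : PowerIdentity commutativeRing q
    element            : Fin q → Carrier
    element-injective  : ∀ {i j} → element i ≈ element j → i ≡ j
    element-surjective : ∀ a → ∃ λ i → element i ≈ a

module _ (R : CommutativeRing 0ℓ 0ℓ) where
  open CommutativeRing R hiding (zero)
  open Exp semiring

  ^-iterate : ∀ {q c} → c ^ q ≈ c → ∀ n → c ^ (q ℕ.^ n) ≈ c
  ^-iterate {q} {c} cq≈c zero    = *-identityʳ c
  ^-iterate {q} {c} cq≈c (suc n) =
    trans (sym (^-assocʳ c q (q ℕ.^ n))) (trans (^-congˡ (q ℕ.^ n) cq≈c) (^-iterate cq≈c n))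

prime⇒1< : ∀ {p} → Prime p → 1 < p
prime⇒1< {p} isPrime = ℕ.nonTrivial⇒n>1 p {{prime⇒nonTrivial isPrime}}

1<m^suc : ∀ {m} k → 1 < m → 1 < m ℕ.^ suc k
1<m^suc {m} k 1<m = ℕ.<-≤-trans 1<m (ℕ.m≤m*n m (m ℕ.^ k) {{ℕ.>-nonZero (ℕ.m^n>0 m k)}})
  where instance m≢0 = ℕ.>-nonZero (ℕ.<-trans (s≤s z≤n) 1<m)

record FieldExtension (p q n : ℕ) : Set₁ where
  field
    finiteField : FiniteField p (q ℕ.^ n)
  open FiniteField finiteField public
  open Exp semiring using (_^_)
  field
    base            : Fin q → Carrier
    base-injective  : ∀ {i j} → base i ≈ base j → i ≡ j
    base^q          : ∀ i → base i ^ q ≈ base i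
    generator       : Carrier
    generator-moves : ∀ d → 0 < d → d < n → ¬ generator ^ (q ℕ.^ d) ≈ generator

module ConjugateDifferences (R : CommutativeRing 0ℓ 0ℓ) (q : ℕ) (x : CommutativeRing.Carrier R) where
  open CommutativeRing R hiding (zero)
  open Exp semiring using (_^_)

  factor : ℕ → Carrier
  factor j = x ^ j - x

  θ : ℕ → Carrier
  θ zero    = 1#
  θ (suc k) = factor (q ℕ.^ suc k) * θ k

-- With n = suc n′, the condition θ≉0 makes the conjugates x ^ (q ^ d), 0 < d < n,
-- differ from x in some residue field.
record PowerAlgebra {p q} (F : FiniteField p q) (n′ : ℕ) (R : CommutativeRing 0ℓ 0ℓ) : Set where
  private module F = FiniteField F
  open CommutativeRing R hiding (zero)
  open Exp semiring using (_^_)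
  open Mult semiring using () renaming (_×_ to _·_)
  field
    characteristic : p · 1# ≈ 0#
    ^qⁿ-identity   : PowerIdentity R (q ℕ.^ suc n′)
    ι              : F.Carrier → Carrier
    ι-cong         : ∀ {c d} → c F.≈ d → ι c ≈ ι d
    ι-1            : ι F.1# ≈ 1#
    ι-*            : ∀ c d → ι (c F.* d) ≈ ι c * ι d
    ι--            : ∀ c d → ι (c F.- d) ≈ ι c - ι d
    ι^q            : ∀ c → ι c ^ q ≈ ι c
    x              : Carrier
  open ConjugateDifferences R q x public
  field
    θ≉0            : ¬ θ n′ ≈ 0#

module _ {p q} {F : FiniteField p q} {n′ : ℕ} {R : CommutativeRing 0ℓ 0ℓ} (P : PowerAlgebra F n′ R) where
  open CommutativeRing R hiding (zero)
  open PowerAlgebra P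

  -- Equations lift to any quotient; the one inequation, that θ is nonzero, survives modulo the
  -- annihilator of `e` because `e * θ n′` is nonzero.
  quotientAlgebra : ∀ e → ¬ e * θ n′ ≈ 0# → PowerAlgebra F n′ (AnnihilatorQuotient.quotient R e)
  quotientAlgebra e eθ≉0 = record
    { characteristic = lift-· p characteristic
    ; ^qⁿ-identity   = λ a → lift-^ (q ℕ.^ suc n′) (^qⁿ-identity a)
    ; ι              = ι
    ; ι-cong         = lift ∘ ι-cong
    ; ι-1            = lift ι-1
    ; ι-*            = λ c d → lift (ι-* c d)
    ; ι--            = λ c d → lift (ι-- c d)
    ; ι^q            = λ c → lift-^ q (ι^q c)
    ; x              = x
    ; θ≉0            = λ θ≈0 → eθ≉0 (trans (reflexive (≡.cong (e *_) (≡.sym (θₑ≡θ n′)))) (trans θ≈0 (zeroʳ e)))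
    }
    where
    open AnnihilatorQuotient R e
    open ConjugateDifferences quotient q x using () renaming (θ to θₑ)
    θₑ≡θ : ∀ k → θₑ k ≡ θ k
    θₑ≡θ zero    = ≡.refl
    θₑ≡θ (suc k) = ≡.cong₂ (λ a b → (a - x) * b) (^∼≡^ x (q ℕ.^ suc k)) (θₑ≡θ k)

  module _ (isField : IsField R) where
    private module F = FiniteField F
    open IsField isField using (1≉0)
    open Exp semiring using (_^_)

    factor≈0⇒θ≈0 : ∀ {d} k → 0 < d → d ≤ k → factor (q ℕ.^ d) ≈ 0# → θ k ≈ 0#
    factor≈0⇒θ≈0 zero    0<d d≤0 _  = contradiction d≤0 (ℕ.<⇒≱ 0<d)
    factor≈0⇒θ≈0 {d} (suc k) 0<d d≤k eq with d ℕ.≟ suc k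
    ... | yes ≡.refl = trans (*-congʳ eq) (zeroˡ (θ k))
    ... | no  d≢1+k  = trans (*-congˡ (factor≈0⇒θ≈0 k 0<d (ℕ.≤-pred (ℕ.≤∧≢⇒< d≤k d≢1+k)) eq)) (zeroʳ _)

    conjugates≉x : ∀ d → 0 < d → d < suc n′ → ¬ x ^ (q ℕ.^ d) ≈ x
    conjugates≉x d 0<d d<n eq = θ≉0 (factor≈0⇒θ≈0 n′ 0<d (ℕ.≤-pred d<n) (trans (+-congʳ eq) (-‿inverseʳ x)))

    -- A nonzero c - d has an inverse in F, and `ι` would turn it into an inverse of zero.
    ι-injective : ∀ {c d} → ι c ≈ ι d → c F.≈ d
    ι-injective {c} {d} eq with c F.≟ d
    ... | yes c≈d = c≈d
    ... | no  c≉d = contradiction 1≈0 1≉0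
      where
      open import Algebra.Properties.Ring F.ring using (x∙y⁻¹≈ε⇒x≈y)
      open import Relation.Binary.Reasoning.Setoid setoid
      u = F.inverse (c F.- d) (c≉d ∘ x∙y⁻¹≈ε⇒x≈y c d)
      1≈0 : 1# ≈ 0#
      1≈0 = begin
        1#                               ≈⟨ ι-1 ⟨
        ι F.1#                           ≈⟨ ι-cong (proj₂ u) ⟨
        ι ((c F.- d) F.* proj₁ u)        ≈⟨ ι-* _ _ ⟩
        ι (c F.- d) * ι (proj₁ u)        ≈⟨ *-congʳ (ι-- c d) ⟩
        (ι c - ι d) * ι (proj₁ u)        ≈⟨ *-congʳ (trans (+-congʳ eq) (-‿inverseʳ (ι d))) ⟩
        0# * ι (proj₁ u)                 ≈⟨ zeroˡ _ ⟩
        0#                               ∎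

-- The power basis of a residue field over the base field.

-- The map c ↦ Σ cᵢ xⁱ on coefficients in F is injective because x has n
-- conjugates, and onto L because all elements of L are roots of X ^ (q ^ n) - X.
module PowerBasis
  {p q} (isPrime : Prime p) {F : FiniteField p q} {n′ : ℕ} (t : ℕ) (qⁿ≡2+t : q ℕ.^ suc n′ ≡ 2 ℕ.+ t)
  {L : CommutativeRing 0ℓ 0ℓ} (isField : IsField L) (P : PowerAlgebra F n′ L)
  where
  open CommutativeRing L hiding (zero)
  open PowerAlgebra P
  private
    module F = FiniteField F
    n = suc n′
    Q = q ℕ.^ n
    e : ℕ
    e = suc (proj₁ F.exponent)
    q≡pᵉ : q ≡ p ℕ.^ e
    q≡pᵉ = proj₂ F.exponent
  open IsField isField
  open FieldProperties L isField
  open Exp semiring using (_^_; ^-assocʳ; ^-congˡ; ^-congʳ)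
  open import Algebra.Properties.CommutativeSemiring.Exp commutativeSemiring using (^-distrib-*)
  open import Relation.Binary.Reasoning.Setoid setoid

  qᵈ≡pᵉᵈ : ∀ d → q ℕ.^ d ≡ p ℕ.^ (e ℕ.* d)
  qᵈ≡pᵉᵈ d = ≡.trans (≡.cong (ℕ._^ d) q≡pᵉ) (ℕ.^-*-assoc p e d)

  ^qᵈ-homo-+ : ∀ d a b → (a + b) ^ (q ℕ.^ d) ≈ a ^ (q ℕ.^ d) + b ^ (q ℕ.^ d)
  ^qᵈ-homo-+ d a b rewrite qᵈ≡pᵉᵈ d = Frobenius.^pᵉ-homo-+ L isPrime characteristic (e ℕ.* d) a b

  0^ : ∀ k → 0 < k → 0# ^ k ≈ 0#
  0^ (suc k) _ = zeroˡ _

  0<qᵈ : ∀ d → 0 < q ℕ.^ d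
  0<qᵈ d = ℕ.m^n>0 q d
    where instance q≢0 = ℕ.≢-nonZero λ q≡0 → contradiction (≡.trans (≡.sym qⁿ≡2+t) (≡.cong (ℕ._^ n) q≡0)) λ ()

  -- The map a ↦ a ^ (q ^ d) respects sums and products and fixes the coefficients.
  eval-conjugate : ∀ d {k} (f : Fin k → Carrier) y → (∀ i → f i ^ q ≈ f i) →
                   eval f (y ^ (q ℕ.^ d)) ≈ eval f y ^ (q ℕ.^ d)
  eval-conjugate d {zero}  f y fixed = sym (0^ _ (0<qᵈ d))
  eval-conjugate d {suc k} f y fixed = begin
    f zero + y ^ r * eval (f ∘ suc) (y ^ r)         ≈⟨ +-cong (sym (^-iterate L (fixed zero) d)) (*-congˡ (eval-conjugate d (f ∘ suc) y (fixed ∘ suc))) ⟩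
    f zero ^ r + y ^ r * eval (f ∘ suc) y ^ r       ≈⟨ +-congˡ (^-distrib-* y _ r) ⟨
    f zero ^ r + (y * eval (f ∘ suc) y) ^ r         ≈⟨ ^qᵈ-homo-+ d _ _ ⟨
    (f zero + y * eval (f ∘ suc) y) ^ r             ∎
    where r = q ℕ.^ d

  -- Raising further to the power q ^ (n - d) undoes the map, by the power identity.
  ^qᵈ-injective : ∀ d → d ≤ n → ∀ {a b} → a ^ (q ℕ.^ d) ≈ b ^ (q ℕ.^ d) → a ≈ b
  ^qᵈ-injective d d≤n {a} {b} eq = trans (sym (up a)) (trans (^-congˡ (q ℕ.^ (n ∸ d)) eq) (up b))
    where
    up : ∀ a → (a ^ (q ℕ.^ d)) ^ (q ℕ.^ (n ∸ d)) ≈ a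
    up a = begin
      (a ^ (q ℕ.^ d)) ^ (q ℕ.^ (n ∸ d))     ≈⟨ ^-assocʳ a (q ℕ.^ d) (q ℕ.^ (n ∸ d)) ⟩
      a ^ (q ℕ.^ d ℕ.* q ℕ.^ (n ∸ d))       ≡⟨ ≡.cong (a ^_) (ℕ.^-distribˡ-+-* q d (n ∸ d)) ⟨
      a ^ (q ℕ.^ (d ℕ.+ (n ∸ d)))           ≡⟨ ≡.cong (λ k → a ^ (q ℕ.^ k)) (ℕ.m+[n∸m]≡n d≤n) ⟩
      a ^ Q                                 ≈⟨ ^qⁿ-identity a ⟩
      a                                     ∎

  -- Cancelling the power q ^ i would make x equal to its conjugate of index j - i, which lies
  -- strictly between 0 and n.
  conjugates-distinct : ∀ i j → i < j → j < n → ¬ x ^ (q ℕ.^ i) ≈ x ^ (q ℕ.^ j)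
  conjugates-distinct i j i<j j<n eq =
    conjugates≉x P isField (j ∸ i) (ℕ.m<n⇒0<n∸m i<j) (ℕ.≤-<-trans (ℕ.m∸n≤m j i) j<n)
      (^qᵈ-injective i (ℕ.<⇒≤ (ℕ.<-trans i<j j<n)) (begin
        (x ^ (q ℕ.^ (j ∸ i))) ^ (q ℕ.^ i)     ≈⟨ ^-assocʳ x (q ℕ.^ (j ∸ i)) (q ℕ.^ i) ⟩
        x ^ (q ℕ.^ (j ∸ i) ℕ.* q ℕ.^ i)       ≡⟨ ≡.cong (x ^_) (ℕ.^-distribˡ-+-* q (j ∸ i) i) ⟨
        x ^ (q ℕ.^ (j ∸ i ℕ.+ i))             ≡⟨ ≡.cong (λ k → x ^ (q ℕ.^ k)) (ℕ.m∸n+n≡m (ℕ.<⇒≤ i<j)) ⟩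
        x ^ (q ℕ.^ j)                         ≈⟨ eq ⟨
        x ^ (q ℕ.^ i)                         ∎))

  conjugate : Fin n → Carrier
  conjugate d = x ^ (q ℕ.^ toℕ d)

  conjugate-injective : ∀ {i j} → conjugate i ≈ conjugate j → i ≡ j
  conjugate-injective {i} {j} eq with ℕ.<-cmp (toℕ i) (toℕ j)
  ... | tri< i<j _ _ = contradiction eq (conjugates-distinct _ _ i<j (Fin.toℕ<n j))
  ... | tri≈ _ i≡j _ = Fin.toℕ-injective i≡j
  ... | tri> _ _ j<i = contradiction (sym eq) (conjugates-distinct _ _ j<i (Fin.toℕ<n i))

  -- Conjugating the equality at x yields it at all n conjugates, so the difference, with n
  -- coefficients, has n distinct roots.
  coefficients-unique : (f g : Fin n → Carrier) → (∀ i → f i ^ q ≈ f i) → (∀ i → g i ^ q ≈ g i) →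
                        eval f x ≈ eval g x → ∀ i → f i ≈ g i
  coefficients-unique f g f-fixed g-fixed eq i = x-y≈0⇒x≈y
    (root-bound (λ i → f i - g i) conjugate conjugate-injective roots i)
    where
    roots : ∀ d → eval (λ i → f i - g i) (conjugate d) ≈ 0#
    roots d = trans (eval-- f g _) (x≈y⇒x-y≈0 (begin
      eval f (conjugate d)       ≈⟨ eval-conjugate (toℕ d) f x f-fixed ⟩
      eval f x ^ (q ℕ.^ toℕ d)   ≈⟨ ^-congˡ (q ℕ.^ toℕ d) eq ⟩
      eval g x ^ (q ℕ.^ toℕ d)   ≈⟨ eval-conjugate (toℕ d) g x g-fixed ⟨
      eval g (conjugate d)       ∎))

  coefficients : Fin Q → Fin n → Carrier
  coefficients j i = ι (F.element (finToFun j i))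

  element : Fin Q → Carrier
  element j = eval (coefficients j) x

  finToFun-injective : ∀ {m k} {i j : Fin (m ℕ.^ k)} → (∀ l → finToFun {m} {k} i l ≡ finToFun j l) → i ≡ j
  finToFun-injective {m} {k} {i} {j} h = ≡.trans (≡.sym (Fin.funToFin-finToFin {k} {m} i))
    (≡.trans (funToFin-cong k h) (Fin.funToFin-finToFin {k} {m} j))
    where
    funToFin-cong : ∀ k {f g : Fin k → Fin m} → (∀ l → f l ≡ g l) → funToFin f ≡ funToFin g
    funToFin-cong zero    _   = ≡.refl
    funToFin-cong (suc k) f≗g = ≡.cong₂ combine (f≗g zero) (funToFin-cong k (f≗g ∘ suc))

  element-injective : ∀ {i j} → element i ≈ element j → i ≡ j
  element-injective {i} {j} eq = finToFun-injective {q} {n} (λ l → F.element-injective (ι-injective P isField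
    (coefficients-unique (coefficients i) (coefficients j) (λ _ → ι^q _) (λ _ → ι^q _) eq l)))

  element-surjective : ∀ a → ∃ λ i → element i ≈ a
  element-surjective a with Fin.any? (λ i → element i ≟ a)
  ... | yes found  = found
  -- A missed value together with the 2 + t attained ones would be 3 + t distinct fixed points of
  -- the power 2 + t.
  ... | no  absent = contradiction fixed (few-fixed-points t ρ ρ-injective)
    where
    ρ : Fin (3 ℕ.+ t) → Carrier
    ρ zero    = a
    ρ (suc i) = element (≡.subst Fin (≡.sym qⁿ≡2+t) i)

    ρ-injective : ∀ {i j} → ρ i ≈ ρ j → i ≡ j
    ρ-injective {zero}  {zero}  _  = ≡.refl
    ρ-injective {zero}  {suc j} eq = contradiction (_ , sym eq) absent
    ρ-injective {suc i} {zero}  eq = contradiction (_ , eq) absent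
    ρ-injective {suc i} {suc j} eq = ≡.cong suc (≡.subst-injective (≡.sym qⁿ≡2+t) (element-injective eq))

    fixed : ∀ i → ρ i ^ (2 ℕ.+ t) ≈ ρ i
    fixed i = trans (^-congʳ (ρ i) (≡.sym qⁿ≡2+t)) (^qⁿ-identity (ρ i))

  finiteField : FiniteField p Q
  finiteField = record
    { commutativeRing    = L
    ; isField            = isField
    ; characteristic     = characteristic
    -- The product `e ℕ.* n` of two successors unfolds to the successor of this number.
    ; exponent           = n′ ℕ.+ proj₁ F.exponent ℕ.* n , qᵈ≡pᵉᵈ n
    ; ^q-identity        = ^qⁿ-identity
    ; element            = element
    ; element-injective  = element-injective
    ; element-surjective = element-surjective
    }

  fieldExtension : FieldExtension p q n
  fieldExtension = record
    { finiteField     = finiteField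
    ; base            = ι ∘ F.element
    ; base-injective  = F.element-injective ∘ ι-injective P isField
    ; base^q          = λ i → ι^q (F.element i)
    ; generator       = x
    ; generator-moves = conjugates≉x P isField
    }

module _ {p q} {F : FiniteField p q} {n′ : ℕ} {R : CommutativeRing 0ℓ 0ℓ} (P : PowerAlgebra F n′ R) where
  open CommutativeRing R hiding (zero)
  open PowerAlgebra P

  -- Modulo the annihilator of the e supplied by `maximalAnnihilator`, the algebra is a field in
  -- which θ is still nonzero, so `PowerBasis` applies.
  residueField : Prime p → Decidable _≈_ → ∀ t → q ℕ.^ suc n′ ≡ 2 ℕ.+ t →
                 ∀ {T} (enumerate : Fin T → Carrier) → (∀ a → ∃ λ i → enumerate i ≈ a) →
                 FieldExtension p q (suc n′)
  residueField isPrime _≟_ t qⁿ≡2+t enumerate enumerate-surjective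
    with MaximalAnnihilator.maximalAnnihilator R _≟_ t (λ a → ≡.subst (λ k → a ^ k ≈ a) qⁿ≡2+t (^qⁿ-identity a))
           enumerate enumerate-surjective (θ n′) θ≉0
    where open Exp semiring using (_^_)
  ... | e , e≉0 , eθ≉0 , zeroOrUnit =
    toExtension (quotientAlgebra P e eθ≉0) record
      { _≟_     = λ a b → (e * a) ≟ (e * b)
      ; 1≉0     = λ e≈0 → e≉0 (trans (sym (*-identityʳ e)) (trans e≈0 (zeroʳ e)))
      ; inverse = inverse
      }
    where
    open AnnihilatorQuotient R e using (_≈ₑ_)
    toExtension : PowerAlgebra F n′ (AnnihilatorQuotient.quotient R e) →
                  IsField (AnnihilatorQuotient.quotient R e) → FieldExtension p q (suc n′)
    toExtension P′ isField = PowerBasis.fieldExtension isPrime t qⁿ≡2+t isField P′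
    inverse : ∀ a → ¬ a ≈ₑ 0# → ∃ λ b → a * b ≈ₑ 1#
    inverse a a≉0 with zeroOrUnit a
    ... | inj₁ ea≈0        = contradiction (trans ea≈0 (sym (zeroʳ e))) a≉0
    ... | inj₂ (b , eab≈e) = b , trans eab≈e (sym (*-identityʳ e))

-- The group algebra of the cyclic group of order Q - 1.

module Extension {p q} (isPrime : Prime p) (F : FiniteField p q) (n′ : ℕ) where
  private
    module F = FiniteField F
    n Q t e : ℕ
    n = suc n′
    Q = q ℕ.^ n
    -- The group then has `suc t` elements, that is Q - 1.
    t = Q ∸ 2
    e = suc (proj₁ F.exponent)

    1<q : 1 < q
    1<q = ≡.subst (1 <_) (≡.sym (proj₂ F.exponent)) (1<m^suc (proj₁ F.exponent) (prime⇒1< isPrime))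

    Q≡2+t : Q ≡ 2 ℕ.+ t
    Q≡2+t = ≡.sym (ℕ.m+[n∸m]≡n (1<m^suc n′ 1<q))

  open GroupAlgebra F.commutativeRing t
  open CommutativeRing algebra hiding (zero)
  open import Algebra.Properties.Semiring.Exp semiring
  open import Algebra.Properties.CommutativeSemiring.Exp commutativeSemiring using (^-distrib-*)
  open import Algebra.Properties.Semiring.Mult semiring using () renaming (_×_ to _·_)
  open Exp F.semiring using () renaming (_^_ to _^F_)
  open Mult F.semiring using () renaming (×-assoc-* to ·F-assoc-*; ×-congʳ to ·F-congʳ)

  algebra-characteristic : p · 1# ≈ 0#
  algebra-characteristic k = F.trans (·-lookup p δ k) (F.trans
    (·F-congʳ p (F.sym (F.*-identityˡ (δ k))))
    (F.trans (F.sym (·F-assoc-* p F.1# (δ k))) (F.trans (F.*-congʳ F.characteristic) (F.zeroˡ (δ k)))))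

  ^Q-homo-+ : ∀ a b → (a + b) ^ Q ≈ a ^ Q + b ^ Q
  ^Q-homo-+ a b = ≡.subst (λ k → (a + b) ^ k ≈ a ^ k + b ^ k)
    (≡.sym (≡.trans (≡.cong (ℕ._^ n) (proj₂ F.exponent)) (ℕ.^-*-assoc p e n)))
    (Frobenius.^pᵉ-homo-+ algebra isPrime algebra-characteristic (e ℕ.* n) a b)

  constant-^ : ∀ c k → constant c ^ k ≈ constant (c ^F k)
  constant-^ c zero    = sym {constant F.1#} {δ} constant-1
  constant-^ c (suc k) = trans {constant c ^ suc k} {constant c * constant (c ^F k)} {constant (c ^F suc k)}
    (*-congˡ {constant c} {constant c ^ k} {constant (c ^F k)} (constant-^ c k))
    (sym {constant (c ^F suc k)} {constant c * constant (c ^F k)} (constant-* c (c ^F k)))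

  constant^q : ∀ c → constant c ^ q ≈ constant c
  constant^q c k = F.trans (constant-^ c q k) (constant-cong (F.^q-identity c) k)

  constant^Q : ∀ c → constant c ^ Q ≈ constant c
  constant^Q c = ^-iterate algebra {q} {constant c} (constant^q c) n

  -- The power `suc t` of the generator is the unit, and Q is one more than `suc t`.
  generator^Q : generator ^ Q ≈ generator
  generator^Q = ≡.subst (λ k → generator ^ k ≈ generator) (≡.sym Q≡2+t) λ k → F.trans (generator-⊛ (generator ^ suc t) k)
    (F.trans (generator^-lookup (suc t) (predᶜ k)) (F.reflexive (≡.cong δ (shift-full (predᶜ k)))))

  Fixed : Element → Set
  Fixed a = a ^ Q ≈ a

  fixed-cong : ∀ {a b} → a ≈ b → Fixed a → Fixed b
  fixed-cong {a} {b} a≈b fixed k = F.trans (^-congˡ Q {b} {a} (≋-sym a≈b) k) (F.trans (fixed k) (a≈b k))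

  fixed-+ : ∀ {a b} → Fixed a → Fixed b → Fixed (a + b)
  fixed-+ {a} {b} a-fixed b-fixed k = F.trans (^Q-homo-+ a b k) (F.+-cong (a-fixed k) (b-fixed k))

  fixed-* : ∀ {a b} → Fixed a → Fixed b → Fixed (a * b)
  fixed-* {a} {b} a-fixed b-fixed k = F.trans (^-distrib-* a b Q k)
    (⊛-cong {a ^ Q} {a} {b ^ Q} {b} a-fixed b-fixed k)

  fixed-1 : Fixed 1#
  fixed-1 = fixed-cong {constant F.1#} {1#} constant-1 (constant^Q F.1#)

  fixed-0 : Fixed 0#
  fixed-0 = fixed-cong {constant F.0#} {0#} (λ k → F.zeroˡ (δ k)) (constant^Q F.0#)

  fixed-generator^ : ∀ j → Fixed (generator ^ j)
  fixed-generator^ zero    = fixed-1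
  fixed-generator^ (suc j) = fixed-* {generator} {generator ^ j} generator^Q (fixed-generator^ j)

  open Sum semiring using (sum)
  open Sum F.semiring using () renaming (sum to sumF)

  fixed-sum : ∀ {k} (f : Fin k → Element) → (∀ i → Fixed (f i)) → Fixed (sum f)
  fixed-sum {zero}  f fixed = fixed-0
  fixed-sum {suc k} f fixed = fixed-+ {f zero} {sum (f ∘ suc)} (fixed zero) (fixed-sum (f ∘ suc) (fixed ∘ suc))

  sum-lookup : ∀ {l} (f : Fin l → Element) k → sum f k ≡ sumF (λ i → f i k)
  sum-lookup {zero}  f k = ≡.refl
  sum-lookup {suc l} f k = ≡.cong (f zero k F.+_) (sum-lookup (f ∘ suc) k)

  -- The fixed points of the Q-th power map are closed under sums and products, since Q is a power
  -- of the characteristic. They contain the constants and the generator, hence by `expansion`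
  -- everything.
  ^Q-identity : ∀ a → a ^ Q ≈ a
  ^Q-identity a = fixed-cong {sum terms} {a}
    (λ k → F.trans (F.reflexive (≡.trans (sum-lookup terms k) (≡.sym (Σ≡sum λ i → terms i k))))
             (F.sym (expansion a k)))
    (fixed-sum terms λ i → fixed-* {constant (a i)} {generator ^ toℕ i} (constant^Q (a i)) (fixed-generator^ (toℕ i)))
    where
    terms : Fin (suc t) → Element
    terms i = constant (a i) * generator ^ toℕ i

  _≋?_ : Decidable _≋_
  a ≋? b = Fin.all? λ k → a k F.≟ b k

  enumerate : Fin (q ℕ.^ suc t) → Element
  enumerate i k = F.element (finToFun i k)

  enumerate-surjective : ∀ a → ∃ λ i → enumerate i ≈ a
  enumerate-surjective a = funToFin code , λ k →
    F.trans (F.reflexive (≡.cong F.element (Fin.finToFun-funToFin code k))) (proj₂ (F.element-surjective (a k)))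
    where
    code : Fin (suc t) → Fin q
    code k = proj₁ (F.element-surjective (a k))

  -- Here v is viewed as a polynomial in the generator with exponents below `suc t`. Both conditions
  -- are vacuous when D exceeds t, hence the bound in `monic≉0`.
  Monic : ℕ → Element → Set
  Monic D v = ∀ k → (toℕ k ≡ D → v k F.≈ F.1#) × (D < toℕ k → v k F.≈ F.0#)

  monic-δ : Monic 0 δ
  monic-δ zero    = (λ _ → F.refl) , λ ()
  monic-δ (suc k) = (λ ()) , λ _ → F.refl

  monic≉0 : ∀ {D v} → D < suc t → Monic D v → ¬ v ≈ 0#
  monic≉0 D<t monic v≈0 = F.1≉0 (F.trans
    (F.sym (proj₁ (monic (fromℕ< D<t)) (Fin.toℕ-fromℕ< D<t))) (v≈0 (fromℕ< D<t)))

  open ConjugateDifferences algebra q generator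

  factor-* : ∀ j v k → (factor j * v) k F.≈ v (shift j k) F.- v (shift 1 k)
  factor-* j v k = F.trans (distribʳ v (generator ^ j) (- generator) k)
    (F.+-cong (generator^-⊛ j v k) (F.trans (F.sym (-‿distribˡ-* generator v k)) (F.-‿cong (generator-⊛ v k))))
    where open import Algebra.Properties.Ring ring using (-‿distribˡ-*)

  -- At indices k ≥ D + j neither shift wraps around. There k - 1 exceeds D because j > 1, so only
  -- the term v (k - j) contributes.
  monic-factor-* : ∀ j {D v} → 1 < j → Monic D v → Monic (D ℕ.+ j) (factor j * v)
  monic-factor-* j {D} {v} 1<j monic k =
    (λ { eq → F.trans (factor-* j v k) (F.trans
       (F.+-cong (proj₁ (monic (shift j k)) (≡.trans (toℕ-shift j k (j≤ (ℕ.≤-reflexive (≡.sym eq))))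
                    (≡.trans (≡.cong (_∸ j) eq) (ℕ.m+n∸n≡m D j))))
                 (neg≈0 (later (ℕ.≤-reflexive (≡.sym eq)))))
       (F.+-identityʳ _)) }) ,
    λ D+j<k → F.trans (factor-* j v k) (F.trans
      (F.+-cong (proj₂ (monic (shift j k)) (≡.subst (D <_) (≡.sym (toℕ-shift j k (j≤ (ℕ.<⇒≤ D+j<k))))
                  (ℕ.m+n≤o⇒m≤o∸n (suc D) D+j<k)))
                (neg≈0 (later (ℕ.<⇒≤ D+j<k))))
      (F.+-identityʳ _))
    where
    open import Algebra.Properties.Ring F.ring using (-0#≈0#)
    j≤ : D ℕ.+ j ≤ toℕ k → j ≤ toℕ k
    j≤ = ℕ.≤-trans (ℕ.m≤n+m j D)
    later : D ℕ.+ j ≤ toℕ k → v (shift 1 k) F.≈ F.0#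
    later D+j≤k = proj₂ (monic (shift 1 k)) (≡.subst (D <_)
      (≡.sym (toℕ-shift 1 k (ℕ.≤-trans (ℕ.<⇒≤ 1<j) (j≤ D+j≤k))))
      (ℕ.m+n≤o⇒m≤o∸n (suc D) (ℕ.≤-trans (ℕ.≤-trans (ℕ.≤-reflexive (≡.sym (ℕ.+-suc D 1))) (ℕ.+-monoʳ-≤ D 1<j)) D+j≤k)))
    neg≈0 : ∀ {a} → a F.≈ F.0# → F.- a F.≈ F.0#
    neg≈0 a≈0 = F.trans (F.-‿cong a≈0) -0#≈0#

  degree : ℕ → ℕ
  degree zero    = 0
  degree (suc k) = degree k ℕ.+ q ℕ.^ suc k

  monic-θ : ∀ k → Monic (degree k) (θ k)
  monic-θ zero    = monic-δ
  monic-θ (suc k) = monic-factor-* (q ℕ.^ suc k) (1<m^suc k 1<q) (monic-θ k)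

  -- The sum of the powers q, ..., q ^ k at least doubles with each new power. The extra `suc` is
  -- kept because the exponents must stay below Q - 1 rather than Q.
  degree-bound : ∀ k → suc (degree k) < q ℕ.^ suc k
  degree-bound zero    = ≡.subst (1 <_) (≡.sym (ℕ.*-identityʳ q)) 1<q
  degree-bound (suc k) = begin-strict
    suc (degree k ℕ.+ r)     <⟨ ℕ.+-monoˡ-< r (degree-bound k) ⟩
    r ℕ.+ r                  ≡⟨ ≡.cong (r ℕ.+_) (ℕ.+-identityʳ r) ⟨
    2 ℕ.* r                  ≤⟨ ℕ.*-monoˡ-≤ r 1<q ⟩
    q ℕ.* r                  ∎
    where
    open ℕ.≤-Reasoning
    r = q ℕ.^ suc k

  θ≉0 : ¬ θ n′ ≈ 0#
  θ≉0 = monic≉0 (ℕ.≤-pred (≡.subst (suc (degree n′) <_) Q≡2+t (degree-bound n′))) (monic-θ n′)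

  constant-- : ∀ c d → constant (c F.- d) ≈ constant c - constant d
  constant-- c d k = F.trans (F.distribʳ (δ k) c (F.- d)) (F.+-congˡ (F.sym (-‿distribˡ-* d (δ k))))
    where open import Algebra.Properties.Ring F.ring using (-‿distribˡ-*)

  powerAlgebra : PowerAlgebra F n′ algebra
  powerAlgebra = record
    { characteristic = algebra-characteristic
    ; ^qⁿ-identity   = ^Q-identity
    ; ι              = constant
    ; ι-cong         = constant-cong
    ; ι-1            = constant-1
    ; ι-*            = constant-*
    ; ι--            = constant--
    ; ι^q            = constant^q
    ; x              = generator
    ; θ≉0            = θ≉0
    }

  fieldExtension : FieldExtension p q n
  fieldExtension = residueField powerAlgebra isPrime _≋?_ t Q≡2+t enumerate enumerate-surjective

-- The prime field as the integers modulo p.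

module IntegersModulo {p} (isPrime : Prime p) where
  private
    open +-*-Solver
    instance
      p≢0 = prime⇒nonZero isPrime

  infix 4 _≡ₚ_
  -- A record, so that the two integers can be inferred from their congruence.
  record _≡ₚ_ (a b : ℤ) : Set where
    constructor mod
    field p∣a-b : + p ℤ∣.∣ a ℤ.- b
  open _≡ₚ_

  lift≡ : ∀ {a b} → a ≡ b → a ≡ₚ b
  lift≡ {a} ≡.refl = mod (≡.subst (+ p ℤ∣.∣_) (≡.sym (ℤ.+-inverseʳ a)) (ℤ∣.∣ᵤ⇒∣ (divides 0 ≡.refl)))

  sym≡ₚ : ∀ {a b} → a ≡ₚ b → b ≡ₚ a
  sym≡ₚ {a} {b} (mod h) = mod (≡.subst (+ p ℤ∣.∣_)
    (solve 2 (λ a b → :- (a :- b) := b :- a) ≡.refl a b) (ℤ∣.∣m⇒∣-m h))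

  trans≡ₚ : ∀ {a b c} → a ≡ₚ b → b ≡ₚ c → a ≡ₚ c
  trans≡ₚ {a} {b} {c} (mod h) (mod k) = mod (≡.subst (+ p ℤ∣.∣_)
    (solve 3 (λ a b c → (a :- b) :+ (b :- c) := a :- c) ≡.refl a b c) (ℤ∣.∣m∣n⇒∣m+n h k))

  +-congₚ : ∀ {a a′ b b′} → a ≡ₚ a′ → b ≡ₚ b′ → a ℤ.+ b ≡ₚ a′ ℤ.+ b′
  +-congₚ {a} {a′} {b} {b′} (mod h) (mod k) = mod (≡.subst (+ p ℤ∣.∣_)
    (solve 4 (λ a a′ b b′ → (a :- a′) :+ (b :- b′) := (a :+ b) :- (a′ :+ b′)) ≡.refl a a′ b b′) (ℤ∣.∣m∣n⇒∣m+n h k))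

  *-congₚ : ∀ {a a′ b b′} → a ≡ₚ a′ → b ≡ₚ b′ → a ℤ.* b ≡ₚ a′ ℤ.* b′
  *-congₚ {a} {a′} {b} {b′} (mod h) (mod k) = mod (≡.subst (+ p ℤ∣.∣_)
    (solve 4 (λ a a′ b b′ → (a :- a′) :* b :+ a′ :* (b :- b′) := a :* b :- a′ :* b′) ≡.refl a a′ b b′)
    (ℤ∣.∣m∣n⇒∣m+n (ℤ∣.∣m⇒∣m*n b h) (ℤ∣.∣n⇒∣m*n a′ k)))

  -‿congₚ : ∀ {a a′} → a ≡ₚ a′ → ℤ.- a ≡ₚ ℤ.- a′
  -‿congₚ {a} {a′} (mod h) = mod (≡.subst (+ p ℤ∣.∣_)
    (solve 2 (λ a a′ → :- (a :- a′) := (:- a) :- (:- a′)) ≡.refl a a′) (ℤ∣.∣m⇒∣-m h))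

  congruence : Congruence ℤ.+-*-commutativeRing
  congruence = record
    { _∼_             = _≡ₚ_
    ; ∼-isEquivalence = record { refl = lift≡ ≡.refl ; sym = sym≡ₚ ; trans = trans≡ₚ }
    ; lift            = lift≡
    ; +-cong∼         = +-congₚ
    ; *-cong∼         = *-congₚ
    ; -‿cong∼         = -‿congₚ
    }

  open Quotient ℤ.+-*-commutativeRing congruence using (quotient)

  module ℤₚ = CommutativeRing quotient
  open Exp ℤₚ.semiring using (_^_; ^-congˡ)
  open Mult ℤₚ.semiring using () renaming (_×_ to _·_)
  open import Algebra.Properties.Ring ℤₚ.ring using (+-inverseʳ-unique)
  open import Relation.Binary.Reasoning.Setoid ℤₚ.setoid

  n·1≡n : ∀ n → n · ℤₚ.1# ≡ + n
  n·1≡n zero    = ≡.refl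
  n·1≡n (suc n) = ≡.cong (λ i → + 1 ℤ.+ i) (n·1≡n n)

  characteristic : p · ℤₚ.1# ≡ₚ + 0
  characteristic = mod (≡.subst (+ p ℤ∣.∣_) (≡.sym (≡.trans (ℤ.+-identityʳ _) (n·1≡n p))) ℤ∣.∣-refl)

  ^p-homo-+ : ∀ a b → (a ℤ.+ b) ^ p ≡ₚ a ^ p ℤ.+ b ^ p
  ^p-homo-+ = Frobenius.^p-homo-+ quotient isPrime characteristic

  1^n≡1 : ∀ n → ℤₚ.1# ^ n ≡ + 1
  1^n≡1 zero    = ≡.refl
  1^n≡1 (suc n) = ≡.trans (ℤ.*-identityˡ _) (1^n≡1 n)

  0^p≡0 : (+ 0) ^ p ≡ₚ + 0
  0^p≡0 = zero^ p
    where
    zero^ : ∀ n .{{_ : ℕ.NonZero n}} → (+ 0) ^ n ≡ₚ + 0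
    zero^ (suc n) = lift≡ (ℤ.*-zeroˡ ((+ 0) ^ n))

  -- Induction through (1 + n) ^ p = 1 + n ^ p.
  fermat⁺ : ∀ n → (+ n) ^ p ≡ₚ + n
  fermat⁺ zero    = 0^p≡0
  fermat⁺ (suc n) = trans≡ₚ (^p-homo-+ (+ 1) (+ n)) (+-congₚ (lift≡ (1^n≡1 p)) (fermat⁺ n))

  fermat : ∀ a → a ^ p ≡ₚ a
  fermat (+ n)      = fermat⁺ n
  -- Additivity of the p-th power on a + (- a) = 0 gives (- a) ^ p = - a ^ p for every p, including
  -- 2.
  fermat (-[1+ n ]) = trans≡ₚ (+-inverseʳ-unique ((+ suc n) ^ p) (-[1+ n ] ^ p) (begin
    (+ suc n) ^ p ℤ.+ -[1+ n ] ^ p    ≈⟨ ^p-homo-+ (+ suc n) -[1+ n ] ⟨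
    (+ suc n ℤ.+ -[1+ n ]) ^ p        ≈⟨ ^-congˡ p (lift≡ (ℤ.+-inverseʳ (+ suc n))) ⟩
    (+ 0) ^ p                         ≈⟨ 0^p≡0 ⟩
    + 0                               ∎)) (-‿congₚ (fermat⁺ (suc n)))

  ∣∣a∣⇒≡0 : ∀ {a} → p ∣ ℤ.∣ a ∣ → a ≡ₚ + 0
  ∣∣a∣⇒≡0 {a} h = mod (≡.subst (+ p ℤ∣.∣_) (≡.sym (ℤ.+-identityʳ a)) (ℤ∣.∣ᵤ⇒∣ h))

  p∣i<p⇒i≡0 : ∀ {i} → p ∣ i → i < p → i ≡ 0
  p∣i<p⇒i≡0 {zero}  _   _   = ≡.refl
  p∣i<p⇒i≡0 {suc i} p∣i i<p = contradiction p∣i (>⇒∤ i<p)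

  -- Fermat makes p divide a (a · a ^ (p - 2) - 1), and Euclid's lemma leaves only the second
  -- factor.
  inverse : ∀ a → ¬ a ≡ₚ + 0 → ∃ λ b → a ℤ.* b ≡ₚ + 1
  inverse a a≢0 = a ^ (p ∸ 2) , [ (λ h → contradiction (∣∣a∣⇒≡0 h) a≢0) , (λ h → mod (ℤ∣.∣ᵤ⇒∣ h)) ]′
    (euclidsLemma ℤ.∣ a ∣ ℤ.∣ a ℤ.* a ^ (p ∸ 2) ℤ.- + 1 ∣ isPrime
      (≡.subst (p ∣_) (ℤ.abs-* a _) (ℤ∣.∣⇒∣ᵤ (≡.subst (+ p ℤ∣.∣_) factored (p∣a-b fermat′)))))
    where
    fermat′ : a ^ (2 ℕ.+ (p ∸ 2)) ≡ₚ a
    fermat′ = ≡.subst (λ n → a ^ n ≡ₚ a) (≡.sym (ℕ.m+[n∸m]≡n (prime⇒1< isPrime))) (fermat a)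
    factored : a ℤ.* (a ℤ.* a ^ (p ∸ 2)) ℤ.- a ≡ a ℤ.* (a ℤ.* a ^ (p ∸ 2) ℤ.- + 1)
    factored = solve 2 (λ a b → a :* b :- a := a :* (b :- con (+ 1))) ≡.refl a (a ℤ.* a ^ (p ∸ 2))

  element-injective : ∀ {i j : Fin p} → + toℕ i ≡ₚ + toℕ j → i ≡ j
  element-injective {i} {j} (mod h) = Fin.toℕ-injective (ℤ.+-injective (ℤ.i-j≡0⇒i≡j (+ toℕ i) (+ toℕ j)
    (ℤ.∣i∣≡0⇒i≡0 (p∣i<p⇒i≡0 (ℤ∣.∣⇒∣ᵤ h) bound))))
    where
    bound : ℤ.∣ + toℕ i ℤ.- + toℕ j ∣ < p
    bound = ≡.subst (λ z → ℤ.∣ z ∣ < p) (≡.sym (ℤ.m-n≡m⊖n (toℕ i) (toℕ j)))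
      (ℕ.≤-<-trans (ℤ.∣m⊝n∣≤m⊔n (toℕ i) (toℕ j)) (ℕ.⊔-lub (Fin.toℕ<n i) (Fin.toℕ<n j)))

  element-surjective : ∀ a → ∃ λ (i : Fin p) → + toℕ i ≡ₚ a
  element-surjective a = fromℕ< r<p , sym≡ₚ (≡.subst (λ r → a ≡ₚ + r) (≡.sym (Fin.toℕ-fromℕ< r<p))
    (mod (ℤ∣.divides (a /ℕ p) (≡.trans
      (≡.cong (ℤ._- + r) (a≡a%ℕn+[a/ℕn]*n a p))
      (solve 2 (λ r b → r :+ b :- r := b) ≡.refl (+ r) ((a /ℕ p) ℤ.* + p))))))
    where
    r = a %ℕ p
    r<p = n%ℕd<d a p

  finiteField : FiniteField p p
  finiteField = record
    { commutativeRing    = quotient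
    ; isField            = record
      { _≟_     = λ a b → map′ mod p∣a-b (+ p ℤ∣.∣? (a ℤ.- b))
      ; 1≉0     = λ 1≡0 → contradiction (prime⇒1< isPrime) (ℕ.<-irrefl (≡.sym (∣1⇒≡1 (ℤ∣.∣⇒∣ᵤ (p∣a-b 1≡0)))))
      ; inverse = inverse
      }
    ; characteristic     = characteristic
    ; exponent           = 0 , ≡.sym (ℕ.*-identityʳ p)
    ; ^q-identity        = fermat
    ; element            = λ i → + toℕ i
    ; element-injective  = element-injective
    ; element-surjective = element-surjective
    }

-- The form N of a cubic automorphism, and the coefficients of the triangle equation.

record CubicAutomorphism (R : CommutativeRing 0ℓ 0ℓ) : Set where
  open CommutativeRing R
  field
    φ      : Carrier → Carrier
    φ-cong : ∀ {a b} → a ≈ b → φ a ≈ φ b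
    φ-+    : ∀ a b → φ (a + b) ≈ φ a + φ b
    φ-*    : ∀ a b → φ (a * b) ≈ φ a * φ b
    φ-1    : φ 1# ≈ 1#
    φ³     : ∀ a → φ (φ (φ a)) ≈ a

Odd : CommutativeRing 0ℓ 0ℓ → Set
Odd R = ¬ 1# + 1# ≈ 0#
  where open CommutativeRing R

module NormForm
  (R : CommutativeRing 0ℓ 0ℓ) (isField : IsField R) (2≉0 : Odd R) (automorphism : CubicAutomorphism R)
  where
  open CommutativeRing R
  open CubicAutomorphism automorphism public
  open IsField isField
  open FieldProperties R isField
  open IntegerCoefficientSolver R
  open import Algebra.Properties.Ring ring using (+-inverseʳ-unique; x+x≈x⇒x≈0)
  open import Relation.Binary.Reasoning.Setoid setoid

  φ-0 : φ 0# ≈ 0#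
  φ-0 = x+x≈x⇒x≈0 (φ 0#) (trans (sym (φ-+ 0# 0#)) (φ-cong (+-identityʳ 0#)))

  φ-neg : ∀ a → φ (- a) ≈ - φ a
  φ-neg a = +-inverseʳ-unique (φ a) (φ (- a)) (trans (sym (φ-+ a (- a))) (trans (φ-cong (-‿inverseʳ a)) φ-0))

  φ-- : ∀ a b → φ (a - b) ≈ φ a - φ b
  φ-- a b = trans (φ-+ a (- b)) (+-congˡ (φ-neg b))

  a+a≈0⇒a≈0 : ∀ {a} → a + a ≈ 0# → a ≈ 0#
  a+a≈0⇒a≈0 {a} a+a≈0 = x*y≈0⇒y≈0 2≉0 (trans (distribʳ a 1# 1#) (trans (+-cong (*-identityˡ a) (*-identityˡ a)) a+a≈0))

  N : Carrier → Carrier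
  N a = a * φ a

  N-cong : ∀ {a b} → a ≈ b → N a ≈ N b
  N-cong a≈b = *-cong a≈b (φ-cong a≈b)

  N-neg : ∀ a → N (- a) ≈ N a
  N-neg a = trans (*-congˡ (φ-neg a)) (solve 2 (λ a b → :- a :* :- b := a :* b) refl a (φ a))

  -- Multiplying x φy ≈ - y φx with its two conjugates gives
  -- x φx φ²x y φy φ²y ≈ - x φx φ²x y φy φ²y.
  polar-nondegenerate : ∀ x y → x * φ y + y * φ x ≈ 0# → x ≈ 0# ⊎ y ≈ 0#
  polar-nondegenerate x y h = [ (λ nx≈0 → inj₁ (norm≈0 x nx≈0)) , (λ ny≈0 → inj₂ (norm≈0 y ny≈0)) ]′
    (x*y≈0⇒x≈0∨y≈0 (a+a≈0⇒a≈0 (begin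
      x * x₁ * x₂ * (y * y₁ * y₂) + x * x₁ * x₂ * (y * y₁ * y₂)
        ≈⟨ solve 6 (λ x x₁ x₂ y y₁ y₂ →
             x :* x₁ :* x₂ :* (y :* y₁ :* y₂) :+ x :* x₁ :* x₂ :* (y :* y₁ :* y₂)
             := (x :* y₁ :+ y :* x₁) :* (x₁ :* y₂ :* (x₂ :* y))
                :- (x₁ :* y₂ :+ y₁ :* x₂) :* (y :* x₁ :* (x₂ :* y))
                :+ (x₂ :* y :+ y₂ :* x) :* (y :* x₁ :* (y₁ :* x₂))) refl x x₁ x₂ y y₁ y₂ ⟩
      (x * y₁ + y * x₁) * (x₁ * y₂ * (x₂ * y)) - (x₁ * y₂ + y₁ * x₂) * (y * x₁ * (x₂ * y))
        + (x₂ * y + y₂ * x) * (y * x₁ * (y₁ * x₂))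
        ≈⟨ +-cong (+-cong (*-congʳ h) (-‿cong (*-congʳ h₁))) (*-congʳ h₂) ⟩
      0# * (x₁ * y₂ * (x₂ * y)) - 0# * (y * x₁ * (x₂ * y)) + 0# * (y * x₁ * (y₁ * x₂))
        ≈⟨ solve 3 (λ a b c → con (+ 0) :* a :- con (+ 0) :* b :+ con (+ 0) :* c := con (+ 0)) refl _ _ _ ⟩
      0# ∎)))
    where
    x₁ = φ x
    x₂ = φ x₁
    y₁ = φ y
    y₂ = φ y₁

    conjugate : ∀ {a b c d} → a * b + c * d ≈ 0# → φ a * φ b + φ c * φ d ≈ 0#
    conjugate {a} {b} {c} {d} eq = begin
      φ a * φ b + φ c * φ d     ≈⟨ +-cong (φ-* a b) (φ-* c d) ⟨
      φ (a * b) + φ (c * d)     ≈⟨ φ-+ (a * b) (c * d) ⟨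
      φ (a * b + c * d)         ≈⟨ φ-cong eq ⟩
      φ 0#                      ≈⟨ φ-0 ⟩
      0#                        ∎

    h₁ : x₁ * y₂ + y₁ * x₂ ≈ 0#
    h₁ = conjugate h

    h₂ : x₂ * y + y₂ * x ≈ 0#
    h₂ = trans (+-cong (*-congˡ (sym (φ³ y))) (*-congˡ (sym (φ³ x)))) (conjugate h₁)

    φ≈0 : ∀ {a} → φ a ≈ 0# → a ≈ 0#
    φ≈0 {a} eq = trans (sym (φ³ a)) (trans (φ-cong (trans (φ-cong eq) φ-0)) φ-0)

    norm≈0 : ∀ a → a * φ a * φ (φ a) ≈ 0# → a ≈ 0#
    norm≈0 a eq with x*y≈0⇒x≈0∨y≈0 eq
    ... | inj₂ φφa≈0 = φ≈0 (φ≈0 φφa≈0)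
    ... | inj₁ aφa≈0 with x*y≈0⇒x≈0∨y≈0 aφa≈0
    ...   | inj₁ a≈0  = a≈0
    ...   | inj₂ φa≈0 = φ≈0 φa≈0

  -- The alternating sum of the four edge equations cancels the primed coordinates. What remains is
  -- κ times the polar form of N at b - d and c - a, settled by `polar-nondegenerate`.
  rectangle-degenerate : ∀ {κ} → ¬ κ ≈ 0# → ∀ {a b c d a′ b′ c′ d′} →
    b′ - a′ ≈ κ * N (b - a) → b′ - c′ ≈ κ * N (b - c) →
    d′ - a′ ≈ κ * N (d - a) → d′ - c′ ≈ κ * N (d - c) → b ≈ d ⊎ c ≈ a
  rectangle-degenerate {κ} κ≉0 {a} {b} {c} {d} {a′} {b′} {c′} {d′} ba bc da dc =
    [ inj₁ ∘ x-y≈0⇒x≈y , inj₂ ∘ x-y≈0⇒x≈y ]′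
      (polar-nondegenerate (b - d) (c - a) (x*y≈0⇒y≈0 κ≉0 (begin
        κ * ((b - d) * φ (c - a) + (c - a) * φ (b - d))
          ≈⟨ *-congˡ (+-cong (*-congˡ (φ-- c a)) (*-congˡ (φ-- b d))) ⟩
        κ * ((b - d) * (φ c - φ a) + (c - a) * (φ b - φ d))
          ≈⟨ solve 9 (λ k a b c d a₁ b₁ c₁ d₁ →
               k :* ((b :- d) :* (c₁ :- a₁) :+ (c :- a) :* (b₁ :- d₁))
               := (k :* ((b :- a) :* (b₁ :- a₁)) :- k :* ((b :- c) :* (b₁ :- c₁)))
                  :- (k :* ((d :- a) :* (d₁ :- a₁)) :- k :* ((d :- c) :* (d₁ :- c₁))))
               refl κ a b c d (φ a) (φ b) (φ c) (φ d) ⟩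
        (κ * ((b - a) * (φ b - φ a)) - κ * ((b - c) * (φ b - φ c)))
          - (κ * ((d - a) * (φ d - φ a)) - κ * ((d - c) * (φ d - φ c)))
          ≈⟨ +-cong (+-cong (edge ba) (-‿cong (edge bc))) (-‿cong (+-cong (edge da) (-‿cong (edge dc)))) ⟩
        ((b′ - a′) - (b′ - c′)) - ((d′ - a′) - (d′ - c′))
          ≈⟨ solve 4 (λ a b c d → ((b :- a) :- (b :- c)) :- ((d :- a) :- (d :- c)) := con (+ 0)) refl a′ b′ c′ d′ ⟩
        0# ∎)))
    where
    edge : ∀ {x y x′ y′} → x′ - y′ ≈ κ * N (x - y) → κ * ((x - y) * (φ x - φ y)) ≈ x′ - y′
    edge {x} {y} eq = trans (*-congˡ (*-congˡ (sym (φ-- x y)))) (sym eq)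

  module Coefficients {c : Carrier} (c-moves : ¬ φ c ≈ c) where
    -- In X′ φY′ - Y′ φX′, with X′ = X + c Y and Y′ = c X + d Y, the terms X φY and Y φX have
    -- coefficients φd - c c₁ and c c₁ - d. They agree when d + φd = 2 c c₁, which this `d`
    -- satisfies, and `γ` is their common value. Subtracting `γ` from the coefficients of N X and N
    -- Y leaves `α` and `β`; `Δ` is the determinant of the substitution.
    c₁ c₂ d d₁ α β γ Δ : Carrier
    c₁ = φ c
    c₂ = φ c₁
    d  = c * c₁ + c * c₂ - c₁ * c₂
    d₁ = c₁ * c₂ + c₁ * c - c₂ * c
    γ  = c₂ * (c₁ - c)
    α  = (c₁ - c) * (1# - c₂)
    β  = (c₁ - c) * (c₂ * c + c₂ * c₁ - c * c₁ - c₂)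
    Δ  = d - c * c

    φd : φ d ≈ d₁
    φd = begin
      φ (c * c₁ + c * c₂ - c₁ * c₂)               ≈⟨ φ-- _ _ ⟩
      φ (c * c₁ + c * c₂) - φ (c₁ * c₂)           ≈⟨ +-cong (trans (φ-+ _ _) (+-cong (φ-* c c₁) (φ-* c c₂))) (-‿cong (φ-* c₁ c₂)) ⟩
      c₁ * c₂ + c₁ * φ c₂ - c₂ * φ c₂             ≈⟨ +-cong (+-congˡ (*-congˡ (φ³ c))) (-‿cong (*-congˡ (φ³ c))) ⟩
      d₁                                          ∎

    c₁-c≉0 : ¬ c₁ - c ≈ 0#
    c₁-c≉0 = c-moves ∘ x-y≈0⇒x≈y

    -- One more application of φ takes c₂ to c, so a fixed c₂ would make c fixed. Used with 0 for
    -- `γ` and with 1 for `α`.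
    c₂≉φ-fixed : ∀ {a} → φ a ≈ a → ¬ c₂ ≈ a
    c₂≉φ-fixed {a} φa≈a c₂≈a = c-moves (trans (φ-cong c≈a) (trans φa≈a (sym c≈a)))
      where
      c≈a : c ≈ a
      c≈a = trans (sym (φ³ c)) (trans (φ-cong c₂≈a) φa≈a)

    c₂-c₁≉0 : ¬ c₂ - c₁ ≈ 0#
    c₂-c₁≉0 eq = c-moves (begin
      c₁             ≈⟨ x-y≈0⇒x≈y eq ⟨
      c₂             ≈⟨ φ-cong (x-y≈0⇒x≈y eq) ⟨
      φ c₂           ≈⟨ φ³ c ⟩
      c              ∎)

    γ≉0 : ¬ γ ≈ 0#
    γ≉0 = *-≉0 (c₂≉φ-fixed φ-0) c₁-c≉0

    α≉0 : ¬ α ≈ 0#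
    α≉0 = *-≉0 c₁-c≉0 (c₂≉φ-fixed φ-1 ∘ sym ∘ x-y≈0⇒x≈y)

    Δ≉0 : ¬ Δ ≈ 0#
    Δ≉0 Δ≈0 = *-≉0 c₁-c≉0 c-c₂≉0 (trans
      (solve 3 (λ c c₁ c₂ → (c₁ :- c) :* (c :- c₂) := c :* c₁ :+ c :* c₂ :- c₁ :* c₂ :- c :* c) refl c c₁ c₂) Δ≈0)
      where
      c-c₂≉0 : ¬ c - c₂ ≈ 0#
      c-c₂≉0 eq = c-moves (trans (φ-cong (x-y≈0⇒x≈y eq)) (φ³ c))

    -- Adding e ≈ 0 to its conjugate gives c + c₂ ≈ 2 c c₂; subtracting from
    -- this its own conjugate gives (c₂ - c₁) (2 c - 1) ≈ 0.
    β≉0 : ¬ β ≈ 0#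
    β≉0 = *-≉0 c₁-c≉0 λ e≈0 → *-≉0 c₂-c₁≉0 2c-1≉0 (begin
      (c₂ - c₁) * (c + c - 1#)
        ≈⟨ solve 4 (λ c c₁ c₂ u → (c₂ :- c₁) :* (c :+ c :- u)
             := (c :* c₂ :+ c :* c₂ :- (c₂ :* u :+ c :* u)) :- (c₁ :* c :+ c₁ :* c :- (c :* u :+ c₁ :* u))) refl c c₁ c₂ 1# ⟩
      (c * c₂ + c * c₂ - (c₂ * 1# + c * 1#)) - (c₁ * c + c₁ * c - (c * 1# + c₁ * 1#))
        ≈⟨ +-cong (+-congˡ (-‿cong (+-cong (*-identityʳ c₂) (*-identityʳ c)))) (-‿cong (+-congˡ (-‿cong (+-cong (*-identityʳ c) (*-identityʳ c₁))))) ⟩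
      (c * c₂ + c * c₂ - (c₂ + c)) - (c₁ * c + c₁ * c - (c + c₁))
        ≈⟨ +-cong (f≈0 e≈0) (-‿cong (f₁≈0 e≈0)) ⟩
      0# - 0#
        ≈⟨ -‿inverseʳ 0# ⟩
      0# ∎)
      where
      φ-polynomial : ∀ w x y z → φ (w + x - y - z) ≈ φ w + φ x - φ y - φ z
      φ-polynomial w x y z = trans (φ-- _ _) (+-congʳ (trans (φ-- _ _) (+-congʳ (φ-+ w x))))

      e₁≈0 : c₂ * c + c₂ * c₁ - c * c₁ - c₂ ≈ 0# → c * c₁ + c * c₂ - c₁ * c₂ - c ≈ 0#
      e₁≈0 e≈0 = begin
        c * c₁ + c * c₂ - c₁ * c₂ - c
          ≈⟨ +-cong (+-congʳ (+-cong (*-congʳ (φ³ c)) (*-congʳ (φ³ c)))) (-‿cong (φ³ c)) ⟨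
        φ c₂ * c₁ + φ c₂ * c₂ - c₁ * c₂ - φ c₂
          ≈⟨ +-congʳ (+-cong (+-cong (φ-* c₂ c) (φ-* c₂ c₁)) (-‿cong (φ-* c c₁))) ⟨
        φ (c₂ * c) + φ (c₂ * c₁) - φ (c * c₁) - φ c₂
          ≈⟨ φ-polynomial _ _ _ _ ⟨
        φ (c₂ * c + c₂ * c₁ - c * c₁ - c₂)
          ≈⟨ trans (φ-cong e≈0) φ-0 ⟩
        0# ∎

      f≈0 : c₂ * c + c₂ * c₁ - c * c₁ - c₂ ≈ 0# → c * c₂ + c * c₂ - (c₂ + c) ≈ 0#
      f≈0 e≈0 = trans
        (solve 3 (λ c c₁ c₂ → c :* c₂ :+ c :* c₂ :- (c₂ :+ c)
           := (c₂ :* c :+ c₂ :* c₁ :- c :* c₁ :- c₂) :+ (c :* c₁ :+ c :* c₂ :- c₁ :* c₂ :- c)) refl c c₁ c₂)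
        (trans (+-cong e≈0 (e₁≈0 e≈0)) (+-identityʳ 0#))

      f₁≈0 : c₂ * c + c₂ * c₁ - c * c₁ - c₂ ≈ 0# → c₁ * c + c₁ * c - (c + c₁) ≈ 0#
      f₁≈0 e≈0 = begin
        c₁ * c + c₁ * c - (c + c₁)
          ≈⟨ +-cong (+-cong (*-congˡ (φ³ c)) (*-congˡ (φ³ c))) (-‿cong (+-congʳ (φ³ c))) ⟨
        c₁ * φ c₂ + c₁ * φ c₂ - (φ c₂ + c₁)
          ≈⟨ +-cong (+-cong (φ-* c c₂) (φ-* c c₂)) (-‿cong (φ-+ c₂ c)) ⟨
        φ (c * c₂) + φ (c * c₂) - φ (c₂ + c)
          ≈⟨ trans (φ-- _ _) (+-congʳ (φ-+ _ _)) ⟨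
        φ (c * c₂ + c * c₂ - (c₂ + c))
          ≈⟨ trans (φ-cong (f≈0 e≈0)) φ-0 ⟩
        0# ∎

      2c-1≉0 : ¬ c + c - 1# ≈ 0#
      2c-1≉0 eq = c₁-c≉0 (a+a≈0⇒a≈0 (begin
        (c₁ - c) + (c₁ - c)    ≈⟨ solve 2 (λ c c₁ → (c₁ :- c) :+ (c₁ :- c) := (c₁ :+ c₁) :- (c :+ c)) refl c c₁ ⟩
        (c₁ + c₁) - (c + c)    ≈⟨ x≈y⇒x-y≈0 (begin
          c₁ + c₁                ≈⟨ φ-+ c c ⟨
          φ (c + c)              ≈⟨ φ-cong (x-y≈0⇒x≈y eq) ⟩
          φ 1#                   ≈⟨ φ-1 ⟩
          1#                     ≈⟨ x-y≈0⇒x≈y eq ⟨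
          c + c                  ∎) ⟩
        0#                     ∎))

    -- For φ-fixed s and r, multiplying (X , Y) by the matrix (1 c ; c d) of
    -- determinant Δ gives l Δ (s , r), a multiple of a φ-fixed vector.
    module _ {s r} (φs≈s : φ s ≈ s) (φr≈r : φ r ≈ r) (l : Carrier) where

      X Y : Carrier
      X = l * (d * s - c * r)
      Y = l * (r - c * s)

      φX : φ X ≈ φ l * (d₁ * s - c₁ * r)
      φX = begin
        φ (l * (d * s - c * r))            ≈⟨ φ-* l _ ⟩
        φ l * φ (d * s - c * r)            ≈⟨ *-congˡ (φ-- _ _) ⟩
        φ l * (φ (d * s) - φ (c * r))      ≈⟨ *-congˡ (+-cong (trans (φ-* d s) (*-cong φd φs≈s)) (-‿cong (trans (φ-* c r) (*-congˡ φr≈r)))) ⟩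
        φ l * (d₁ * s - c₁ * r)            ∎

      φY : φ Y ≈ φ l * (r - c₁ * s)
      φY = begin
        φ (l * (r - c * s))           ≈⟨ φ-* l _ ⟩
        φ l * φ (r - c * s)           ≈⟨ *-congˡ (φ-- r _) ⟩
        φ l * (φ r - φ (c * s))       ≈⟨ *-congˡ (+-cong φr≈r (-‿cong (trans (φ-* c s) (*-congˡ φs≈s)))) ⟩
        φ l * (r - c₁ * s)            ∎

      -- With (X′ , Y′) = l Δ (s , r) and s, r fixed, both X′ φY′ and Y′ φX′ equal l Δ φ(l Δ) s r.
      -- The solver checks the expanded identity once φX and φY are substituted.
      triangle-identity : α * N X + β * N Y ≈ - γ * N (X + Y)
      triangle-identity = begin
        α * (X * φ X) + β * (Y * φ Y)
          ≈⟨ +-cong (*-congˡ (*-congˡ φX)) (*-congˡ (*-congˡ φY)) ⟩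
        α * (X * φX′) + β * (Y * φY′)
          -- Multiplying out `α` removes the constant 1 from the identity passed to the solver.
          ≈⟨ +-congʳ (*-congʳ (trans (solve 3 (λ a b u → a :* (u :- b) := a :* u :- a :* b) refl (c₁ - c) c₂ 1#) (+-congʳ (*-identityʳ _)))) ⟩
        (c₁ - c - (c₁ - c) * c₂) * (X * φX′) + β * (Y * φY′)
          ≈⟨ solve 7 (λ c c₁ c₂ s r l m →
               let x  = (c :* c₁ :+ c :* c₂ :- c₁ :* c₂) :* s :- c :* r
                   y  = r :- c :* s
                   x₁ = (c₁ :* c₂ :+ c₁ :* c :- c₂ :* c) :* s :- c₁ :* r
                   y₁ = r :- c₁ :* s
               in (c₁ :- c :- (c₁ :- c) :* c₂) :* (l :* x :* (m :* x₁))
                    :+ (c₁ :- c) :* (c₂ :* c :+ c₂ :* c₁ :- c :* c₁ :- c₂) :* (l :* y :* (m :* y₁))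
                  := :- (c₂ :* (c₁ :- c)) :* ((l :* x :+ l :* y) :* (m :* x₁ :+ m :* y₁)))
               refl c c₁ c₂ s r l (φ l) ⟩
        - γ * ((X + Y) * (φX′ + φY′))
          ≈⟨ *-congˡ (*-congˡ (trans (φ-+ X Y) (+-cong φX φY))) ⟨
        - γ * ((X + Y) * φ (X + Y)) ∎
        where
        φX′ = φ l * (d₁ * s - c₁ * r)
        φY′ = φ l * (r - c₁ * s)

      -- With the next identity, this recovers l s and l r from X and Y, for the injectivity of the
      -- triangle count.
      X+cY : X + c * Y ≈ Δ * (l * s)
      X+cY = solve 5 (λ c d s r l →
        l :* (d :* s :- c :* r) :+ c :* (l :* (r :- c :* s)) := (d :- c :* c) :* (l :* s)) refl c d s r l

      cX+dY : c * X + d * Y ≈ Δ * (l * r)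
      cX+dY = solve 5 (λ c d s r l →
        c :* (l :* (d :* s :- c :* r)) :+ d :* (l :* (r :- c :* s)) := (d :- c :* c) :* (l :* r)) refl c d s r l

-- Lower bounds from injections.

injection⇒length≥ : ∀ {A : Set} {m} (xs : List A) (f : Fin m → A) →
                    Injective _≡_ _≡_ f → (∀ i → f i ∈ xs) → m ≤ length xs
injection⇒length≥ xs f f-injective f∈xs = Fin.injective⇒≤ {f = index ∘ f∈xs} λ {i} {j} eq →
  f-injective (≡.trans (lookup-index (f∈xs i)) (≡.trans (≡.cong (lookup xs) eq) (≡.sym (lookup-index (f∈xs j)))))

injection⇒triangles≥ : ∀ {k m} (G : SimpleGraph (Vertex k)) (f : Fin m → Fin k × Fin k × Fin k) →
                       Injective _≡_ _≡_ f → (∀ i → IsTriangle G (f i)) → m ≤ triangles G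
injection⇒triangles≥ G f f-injective isTriangle = injection⇒length≥ _ f f-injective λ i →
  ∈-filter⁺ (isTriangle? G) (∈-cartesianProduct⁺ (∈-allFin _) (∈-cartesianProduct⁺ (∈-allFin _) (∈-allFin _))) (isTriangle i)

remQuot-injective : ∀ {m} n → Injective _≡_ _≡_ (remQuot {m} n)
remQuot-injective {m} n {i} {j} eq = ≡.trans (≡.sym (Fin.combine-remQuot {m} n i))
  (≡.trans (≡.cong (uncurry combine) eq) (Fin.combine-remQuot {m} n j))

splitAt-injective : ∀ m {n} → Injective _≡_ _≡_ (splitAt m {n})
splitAt-injective m {n} {i} {j} eq = ≡.trans (≡.sym (Fin.join-splitAt m n i))
  (≡.trans (≡.cong (join m n) eq) (Fin.join-splitAt m n j))

-- The graph, its admissibility and its triangles.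

record PlaneCoordinates (R : CommutativeRing 0ℓ 0ℓ) (k : ℕ) : Set where
  open CommutativeRing R
  field
    v w                : Fin k → Carrier
    points-distinct    : ∀ {i j} → v i ≈ v j → w i ≈ w j → i ≡ j
    points-exhaustive  : ∀ a b → ∃ λ i → v i ≈ a × w i ≈ b

module NormGraph
  (R : CommutativeRing 0ℓ 0ℓ) (isField : IsField R) (2≉0 : Odd R) (automorphism : CubicAutomorphism R)
  {c : CommutativeRing.Carrier R}
  (c-moves : ¬ CommutativeRing._≈_ R (CubicAutomorphism.φ automorphism c) c)
  {k} (plane : PlaneCoordinates R k)
  where
  open CommutativeRing R hiding (zero)
  open PlaneCoordinates plane
  open IsField isField
  open FieldProperties R isField
  open IntegerCoefficientSolver R
  open import Algebra.Properties.Ring ring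
    using (-0#≈0#; -‿involutive; ⁻¹-anti-homo‿-; -‿distribˡ-*; +-cancelʳ)
  open NormForm R isField 2≉0 automorphism
  open Coefficients c-moves
  open import Relation.Binary.Reasoning.Setoid setoid

  -- Antisymmetry, with N even, makes adjacency symmetric. The sign at parts 0 and 2 turns α N X + β
  -- N Y + γ N (X + Y) = 0 into the third edge of a triangle.
  κ : Fin 3 → Fin 3 → Carrier
  κ 0F 1F = α
  κ 1F 0F = - α
  κ 1F 2F = β
  κ 2F 1F = - β
  κ 0F 2F = - γ
  κ 2F 0F = γ
  κ 0F 0F = 0#
  κ 1F 1F = 0#
  κ 2F 2F = 0#

  κ-antisym : ∀ i j → κ j i ≈ - κ i j
  κ-antisym 0F 0F = sym -0#≈0#
  κ-antisym 1F 1F = sym -0#≈0#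
  κ-antisym 2F 2F = sym -0#≈0#
  κ-antisym 0F 1F = refl
  κ-antisym 1F 2F = refl
  κ-antisym 2F 0F = refl
  κ-antisym 1F 0F = sym (-‿involutive α)
  κ-antisym 2F 1F = sym (-‿involutive β)
  κ-antisym 0F 2F = sym (-‿involutive γ)

  neg≉0 : ∀ {a} → ¬ a ≈ 0# → ¬ - a ≈ 0#
  neg≉0 {a} a≉0 -a≈0 = a≉0 (trans (sym (-‿involutive a)) (trans (-‿cong -a≈0) -0#≈0#))

  κ≉0 : ∀ i j → i ≢ j → ¬ κ i j ≈ 0#
  κ≉0 0F 0F i≢i = contradiction ≡.refl i≢i
  κ≉0 1F 1F i≢i = contradiction ≡.refl i≢i
  κ≉0 2F 2F i≢i = contradiction ≡.refl i≢i
  κ≉0 0F 1F _   = α≉0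
  κ≉0 1F 2F _   = β≉0
  κ≉0 2F 0F _   = γ≉0
  κ≉0 1F 0F _   = neg≉0 α≉0
  κ≉0 2F 1F _   = neg≉0 β≉0
  κ≉0 0F 2F _   = neg≉0 γ≉0

  Adjacent : Vertex k → Vertex k → Set
  Adjacent (i , x) (j , y) = i ≢ j × w y - w x ≈ κ i j * N (v y - v x)

  adjacent-sym : ∀ {a b} → Adjacent a b → Adjacent b a
  adjacent-sym {i , x} {j , y} (i≢j , eq) = i≢j ∘ ≡.sym , (begin
    w x - w y                       ≈⟨ ⁻¹-anti-homo‿- (w y) (w x) ⟨
    - (w y - w x)                   ≈⟨ -‿cong eq ⟩
    - (κ i j * N (v y - v x))       ≈⟨ -‿distribˡ-* _ _ ⟩
    - κ i j * N (v y - v x)         ≈⟨ *-cong (κ-antisym i j) (trans (N-cong (sym (⁻¹-anti-homo‿- (v y) (v x)))) (N-neg _)) ⟨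
    κ j i * N (v x - v y)           ∎)

  graph : SimpleGraph (Vertex k)
  graph = record
    { _~_         = Adjacent
    ; _~?_        = λ { (i , x) (j , y) → ¬? (i Fin.≟ j) ×-dec ((w y - w x) ≟ (κ i j * N (v y - v x))) }
    ; symmetric   = adjacent-sym
    ; irreflexive = λ (i≢i , _) → i≢i ≡.refl
    }

  -- Given the neighbour z, the edge equation computes `w` from `v`.
  same-v⇒≡ : ∀ {i j x y z} → v x ≈ v y → w x - w z ≈ κ i j * N (v x - v z) →
             w y - w z ≈ κ i j * N (v y - v z) → x ≡ y
  same-v⇒≡ {z = z} vx≈vy eqx eqy = points-distinct vx≈vy
    (+-cancelʳ (- w z) _ _ (trans eqx (trans (*-congˡ (N-cong (+-congʳ vx≈vy))) (sym eqy))))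

  no-rectangle : ∀ i j {a b c d} → a ≢ c → b ≢ d →
                 Adjacent (i , a) (j , b) → Adjacent (i , c) (j , b) →
                 ¬ (Adjacent (i , a) (j , d) × Adjacent (i , c) (j , d))
  no-rectangle i j {a} {b} {c} {d} a≢c b≢d ab@(i≢j , eab) cb@(_ , ecb) (ad@(_ , ead) , cd@(_ , ecd))
    = [ (λ vb≈vd → b≢d (same-v⇒≡ {i} {j} vb≈vd eab ead))
      , (λ vc≈va → a≢c (≡.sym (same-v⇒≡ {j} {i} vc≈va (proj₂ (adjacent-sym cb)) (proj₂ (adjacent-sym ab)))))
      ]′ (rectangle-degenerate (κ≉0 i j i≢j) {v a} {v b} {v c} {v d} eab ecb ead ecd)

  admissible : Admissible graph
  admissible = (λ _ _ → proj₁) , c₄-free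
    where
    c₄-free : PairwiseC4Free graph
    c₄-free i j i≢j ((ia , a) , (ib , b) , (ic , c) , (id , d) , a≢c , b≢d ,
                     (ab , jab) , (bc , jbc) , (cd , jcd) , (da , jda)) = go jab jbc jcd
      where
      -- The walk has to alternate between the two parts; every other pattern puts one vertex into
      -- both and forces i = j.
      go : Joins i j (ia , a) (ib , b) → Joins i j (ib , b) (ic , c) → Joins i j (ic , c) (id , d) → _
      go (inj₁ (≡.refl , ≡.refl)) (inj₁ (≡.refl , _)) _ = i≢j ≡.refl
      go (inj₁ (≡.refl , ≡.refl)) (inj₂ (≡.refl , ≡.refl)) (inj₂ (≡.refl , _)) = i≢j ≡.refl
      go (inj₁ (≡.refl , ≡.refl)) (inj₂ (≡.refl , ≡.refl)) (inj₁ (≡.refl , ≡.refl)) =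
        no-rectangle i j (a≢c ∘ ≡.cong (i ,_)) (b≢d ∘ ≡.cong (j ,_)) ab (adjacent-sym bc) (adjacent-sym da , cd)
      go (inj₂ (≡.refl , ≡.refl)) (inj₂ (≡.refl , _)) _ = i≢j ≡.refl
      go (inj₂ (≡.refl , ≡.refl)) (inj₁ (≡.refl , ≡.refl)) (inj₁ (≡.refl , _)) = i≢j ≡.refl
      go (inj₂ (≡.refl , ≡.refl)) (inj₁ (≡.refl , ≡.refl)) (inj₂ (≡.refl , ≡.refl)) =
        no-rectangle j i (a≢c ∘ ≡.cong (j ,_)) (b≢d ∘ ≡.cong (i ,_)) ab (adjacent-sym bc) (adjacent-sym da , cd)

  -- From x, the steps X and Y in the first coordinate fix the other two vertices, with second
  -- coordinates chosen to give the edges xy and yz. The edge xz is `triangle-identity`.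
  module TriangleAt (x : Fin k) (l : Carrier) {s r} (φs≈s : φ s ≈ s) (φr≈r : φ r ≈ r) where
    private
      X′ = X φs≈s φr≈r l
      Y′ = Y φs≈s φr≈r l
      second = points-exhaustive (v x + X′) (w x + α * N X′)
      y = proj₁ second
      third = points-exhaustive (v y + Y′) (w y + β * N Y′)
      z = proj₁ third

      sum-difference : ∀ {a b t} → b ≈ a + t → b - a ≈ t
      sum-difference {a} {b} {t} eq = trans (+-congʳ eq) (solve 2 (λ a t → a :+ t :- a := t) refl a t)

    triangle : Fin k × Fin k × Fin k
    triangle = x , y , z

    vy-vx : v y - v x ≈ X′
    vy-vx = sum-difference (proj₁ (proj₂ second))

    vz-vy : v z - v y ≈ Y′
    vz-vy = sum-difference (proj₁ (proj₂ third))

    private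
      wy-wx : w y - w x ≈ α * N X′
      wy-wx = sum-difference (proj₂ (proj₂ second))

      wz-wy : w z - w y ≈ β * N Y′
      wz-wy = sum-difference (proj₂ (proj₂ third))

      telescope : ∀ {a b c t u} → b - a ≈ t → c - b ≈ u → c - a ≈ t + u
      telescope {a} {b} {c} p q = trans (solve 3 (λ a b c → c :- a := (b :- a) :+ (c :- b)) refl a b c) (+-cong p q)

    isTriangle : IsTriangle graph triangle
    isTriangle = ((λ ()) , trans wy-wx (*-congˡ (N-cong (sym vy-vx))))
               , ((λ ()) , trans wz-wy (*-congˡ (N-cong (sym vz-vy))))
               , ((λ ()) , trans (telescope wy-wx wz-wy)
                   (trans (triangle-identity φs≈s φr≈r l) (*-congˡ (N-cong (sym (telescope vy-vx vz-vy))))))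

  -- The differences of first coordinates recover X and Y; the matrix of determinant `Δ` turns these
  -- into Δ l s and Δ l r, and `Δ` cancels.
  triangle-determines : ∀ {x l s r x′ l′ s′ r′}
    (φs : φ s ≈ s) (φr : φ r ≈ r) (φs′ : φ s′ ≈ s′) (φr′ : φ r′ ≈ r′) →
    TriangleAt.triangle x l φs φr ≡ TriangleAt.triangle x′ l′ φs′ φr′ →
    x ≡ x′ × l * s ≈ l′ * s′ × l * r ≈ l′ * r′
  triangle-determines {x} {l} {s} {r} {x′} {l′} {s′} {r′} φs φr φs′ φr′ eq =
    ≡.cong proj₁ eq ,
    *-cancelˡ-≉0 Δ≉0 (trans (sym (X+cY φs φr l)) (trans (+-cong same-X (*-congˡ same-Y)) (X+cY φs′ φr′ l′))) ,
    *-cancelˡ-≉0 Δ≉0 (trans (sym (cX+dY φs φr l)) (trans (+-cong (*-congˡ same-X) (*-congˡ same-Y)) (cX+dY φs′ φr′ l′)))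
    where
    module T  = TriangleAt x l φs φr
    module T′ = TriangleAt x′ l′ φs′ φr′
    same-X : X φs φr l ≈ X φs′ φr′ l′
    same-X = trans (sym T.vy-vx) (trans (reflexive (≡.cong (λ (x , y , z) → v y - v x) eq)) T′.vy-vx)
    same-Y : Y φs φr l ≈ Y φs′ φr′ l′
    same-Y = trans (sym T.vz-vy) (trans (reflexive (≡.cong (λ (x , y , z) → v z - v y) eq)) T′.vz-vy)

  module Count
    {M} (scalar : Fin M → Carrier) (scalar-injective : ∀ {i j} → scalar i ≈ scalar j → i ≡ j)
    (scalar≉0 : ∀ i → ¬ scalar i ≈ 0#)
    {q} (base : Fin q → Carrier) (base-injective : ∀ {i j} → base i ≈ base j → i ≡ j)
    (φ-base : ∀ i → φ (base i) ≈ base i)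
    where

    -- The projective line over the fixed field of φ.
    direction : Fin q ⊎ Fin 1 → Carrier × Carrier
    direction (inj₁ i) = 1# , base i
    direction (inj₂ _) = 0# , 1#

    φ-direction : ∀ t → φ (proj₁ (direction t)) ≈ proj₁ (direction t) × φ (proj₂ (direction t)) ≈ proj₂ (direction t)
    φ-direction (inj₁ i) = φ-1 , φ-base i
    φ-direction (inj₂ _) = φ-0 , φ-1

    -- The first nonzero coordinate of each direction is 1, so the multiple displays the scalar
    -- there, and cancelling it leaves the direction.
    direction-injective : ∀ {i j} t u →
      scalar i * proj₁ (direction t) ≈ scalar j * proj₁ (direction u) →
      scalar i * proj₂ (direction t) ≈ scalar j * proj₂ (direction u) → i ≡ j × t ≡ u
    direction-injective {i} {j} (inj₁ a) (inj₁ b) p r = ≡i ,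
      ≡.cong inj₁ (base-injective (*-cancelˡ-≉0 (scalar≉0 i) (trans r (*-congʳ (reflexive (≡.cong scalar (≡.sym ≡i)))))))
      where
      ≡i : i ≡ j
      ≡i = scalar-injective (trans (sym (*-identityʳ _)) (trans p (*-identityʳ _)))
    direction-injective {i} (inj₁ _) (inj₂ _) p r = contradiction (trans (sym (*-identityʳ _)) (trans p (zeroʳ _))) (scalar≉0 i)
    direction-injective {j = j} (inj₂ _) (inj₁ _) p r = contradiction (trans (sym (*-identityʳ _)) (trans (sym p) (zeroʳ _))) (scalar≉0 j)
    direction-injective (inj₂ 0F) (inj₂ 0F) p r = scalar-injective (trans (sym (*-identityʳ _)) (trans r (*-identityʳ _))) , ≡.refl

    triangleOf : Fin k → Fin M → Fin q ⊎ Fin 1 → Fin k × Fin k × Fin k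
    triangleOf x i t = TriangleAt.triangle x (scalar i) (proj₁ (φ-direction t)) (proj₂ (φ-direction t))

    triangleOf-injective : ∀ {x i t x′ i′ t′} → triangleOf x i t ≡ triangleOf x′ i′ t′ → x ≡ x′ × i ≡ i′ × t ≡ t′
    triangleOf-injective {t = t} {t′ = t′} eq = proj₁ determined ,
      direction-injective t t′ (proj₁ (proj₂ determined)) (proj₂ (proj₂ determined))
      where
      determined = triangle-determines (proj₁ (φ-direction t)) (proj₂ (φ-direction t))
                     (proj₁ (φ-direction t′)) (proj₂ (φ-direction t′)) eq

    vertexScalar : Fin (k ℕ.* M ℕ.* (q ℕ.+ 1)) → Fin k × Fin M
    vertexScalar n = remQuot {k} M (proj₁ (remQuot {k ℕ.* M} (q ℕ.+ 1) n))

    directionIndex : Fin (k ℕ.* M ℕ.* (q ℕ.+ 1)) → Fin q ⊎ Fin 1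
    directionIndex n = splitAt q (proj₂ (remQuot {k ℕ.* M} (q ℕ.+ 1) n))

    indexed : Fin (k ℕ.* M ℕ.* (q ℕ.+ 1)) → Fin k × Fin k × Fin k
    indexed n = triangleOf (proj₁ (vertexScalar n)) (proj₂ (vertexScalar n)) (directionIndex n)

    indexed-injective : Injective _≡_ _≡_ indexed
    indexed-injective {m} {n} eq = remQuot-injective {k ℕ.* M} (q ℕ.+ 1)
      (≡.cong₂ _,_ (remQuot-injective {k} M (≡.cong₂ _,_ (proj₁ components) (proj₁ (proj₂ components))))
                   (splitAt-injective q (proj₂ (proj₂ components))))
      where components = triangleOf-injective {t = directionIndex m} {t′ = directionIndex n} eq

    triangles≥ : k ℕ.* M ℕ.* (q ℕ.+ 1) ≤ triangles graph
    triangles≥ = injection⇒triangles≥ graph indexed indexed-injective λ n →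
      TriangleAt.isTriangle (proj₁ (vertexScalar n)) (scalar (proj₂ (vertexScalar n)))
        (proj₁ (φ-direction (directionIndex n))) (proj₂ (φ-direction (directionIndex n)))

-- Odd characteristic, units and plane coordinates in a finite field.

odd⇒≡1+2k : ∀ {p} → ¬ 2 ∣ p → p ≡ suc (p / 2 ℕ.* 2)
odd⇒≡1+2k {p} 2∤p = ≡.trans (m≡m%n+[m/n]*n p 2) (≡.cong (ℕ._+ p / 2 ℕ.* 2) (remainder (p % 2) (m%n<n p 2) (2∤p ∘ m%n≡0⇒n∣m p 2)))
  where
  remainder : ∀ r → r ℕ.< 2 → r ≢ 0 → r ≡ 1
  remainder 0 _ r≢0 = contradiction ≡.refl r≢0
  remainder 1 _ _   = ≡.refl
  remainder (suc (suc r)) (s≤s (s≤s ())) _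

module _ {p q} (F : FiniteField p q) where
  open FiniteField F
  open Mult semiring using () renaming (_×_ to _·_)
  open import Relation.Binary.Reasoning.Setoid setoid

  -- If 2 were 0, then p = 1 + 2m would give p · 1 = 1, yet p · 1 = 0. The even multiple vanishes by
  -- the Frobenius lemma taken at the prime 2.
  odd⇒2≉0 : ¬ 2 ∣ p → Odd commutativeRing
  odd⇒2≉0 2∤p 2≈0 = 1≉0 (begin
    1#                            ≈⟨ +-identityʳ 1# ⟨
    1# + 0#                       ≈⟨ +-congˡ (Frobenius.p∣n⇒n·x≈0 commutativeRing prime[2]
                                       (trans (sym (+-assoc 1# 1# 0#)) (trans (+-identityʳ _) 2≈0)) 1# (divides (p / 2) ≡.refl)) ⟨
    suc (p / 2 ℕ.* 2) · 1#          ≡⟨ ≡.cong (_· 1#) (odd⇒≡1+2k 2∤p) ⟨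
    p · 1#                        ≈⟨ characteristic ⟩
    0#                            ∎)

  -- The enumeration of the field with the index of zero skipped by `punchIn`.
  units : ∃ λ (u : Fin (q ∸ 1) → Carrier) → (∀ {i j} → u i ≈ u j → i ≡ j) × (∀ i → ¬ u i ≈ 0#)
  units = avoid q element element-injective (element-surjective 0#)
    where
    avoid : ∀ q (f : Fin q → Carrier) → (∀ {i j} → f i ≈ f j → i ≡ j) → (∃ λ z → f z ≈ 0#) →
            ∃ λ (u : Fin (q ∸ 1) → Carrier) → (∀ {i j} → u i ≈ u j → i ≡ j) × (∀ i → ¬ u i ≈ 0#)
    avoid (suc _) f f-injective (z , fz≈0) =
      f ∘ punchIn z , Fin.punchIn-injective z _ _ ∘ f-injective ,
      λ i eq → Fin.punchInᵢ≢i z i (f-injective (trans eq (sym fz≈0)))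

  module Plane {k} (k≡q*q : k ≡ q ℕ.* q) where

    coordinates : Fin k → Fin q × Fin q
    coordinates i = remQuot q (≡.subst Fin k≡q*q i)

    coordinates-injective : ∀ {i j} → coordinates i ≡ coordinates j → i ≡ j
    coordinates-injective eq = ≡.subst-injective k≡q*q (remQuot-injective {q} q eq)

    coordinates-surjective : ∀ ij → ∃ λ i → coordinates i ≡ ij
    coordinates-surjective (i , j) = ≡.subst Fin (≡.sym k≡q*q) (combine i j) ,
      ≡.trans (≡.cong (remQuot q) (≡.subst-subst-sym k≡q*q)) (Fin.remQuot-combine i j)

    plane : PlaneCoordinates commutativeRing k
    plane = record
      { v                 = element ∘ proj₁ ∘ coordinates
      ; w                 = element ∘ proj₂ ∘ coordinates
      ; points-distinct   = λ p r → coordinates-injective (≡.cong₂ _,_ (element-injective p) (element-injective r))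
      ; points-exhaustive = λ a b →
          let i , i≈a = element-surjective a
              j , j≈b = element-surjective b
              l , eq  = coordinates-surjective (i , j)
          in l , trans (reflexive (≡.cong (element ∘ proj₁) eq)) i≈a
               , trans (reflexive (≡.cong (element ∘ proj₂) eq)) j≈b
      }

-- The bound from a cubic extension, with φ the q-th power map.

module _ {p q} (isPrime : Prime p) (2∤p : ¬ 2 ∣ p) (E : FieldExtension p q 3) (e : ℕ) (q≡pᵉ : q ≡ p ℕ.^ e) where
  open FieldExtension E
  open Exp semiring using (_^_; ^-congˡ; ^-assocʳ)
  open import Algebra.Properties.CommutativeSemiring.Exp commutativeSemiring using (^-distrib-*)

  φ : Carrier → Carrier
  φ a = a ^ q

  φ-+ : ∀ a b → φ (a + b) ≈ φ a + φ b
  φ-+ a b = ≡.subst (λ n → (a + b) ^ n ≈ a ^ n + b ^ n) (≡.sym q≡pᵉ)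
    (Frobenius.^pᵉ-homo-+ commutativeRing isPrime characteristic e a b)

  φ-1 : φ 1# ≈ 1#
  φ-1 = FieldProperties.1^n≈1 commutativeRing isField q

  φ³ : ∀ a → φ (φ (φ a)) ≈ a
  φ³ a = begin
    ((a ^ q) ^ q) ^ q             ≈⟨ ^-assocʳ (a ^ q) q q ⟩
    (a ^ q) ^ (q ℕ.* q)           ≈⟨ ^-assocʳ a q (q ℕ.* q) ⟩
    a ^ (q ℕ.* (q ℕ.* q))         ≡⟨ ≡.cong (λ n → a ^ (q ℕ.* (q ℕ.* n))) (ℕ.*-identityʳ q) ⟨
    a ^ (q ℕ.^ 3)                 ≈⟨ ^q-identity a ⟩
    a                             ∎
    where open import Relation.Binary.Reasoning.Setoid setoid

  generator-φ : ¬ φ generator ≈ generator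
  generator-φ = generator-moves 1 (s≤s z≤n) (s≤s (s≤s z≤n)) ∘ trans (reflexive (≡.cong (generator ^_) (ℕ.*-identityʳ q)))

  automorphism : CubicAutomorphism commutativeRing
  automorphism = record
    { φ = φ ; φ-cong = ^-congˡ q ; φ-+ = φ-+ ; φ-* = λ a b → ^-distrib-* a b q ; φ-1 = φ-1 ; φ³ = φ³ }

  -- The field has q ^ 3 elements, so a part of size q ^ 6 is the plane over it.
  module G = NormGraph commutativeRing isField (odd⇒2≉0 finiteField 2∤p) automorphism generator-φ
    (Plane.plane finiteField (ℕ.^-distribˡ-+-* q 3 3))

  module C = G.Count (proj₁ (units finiteField)) (proj₁ (proj₂ (units finiteField))) (proj₂ (proj₂ (units finiteField)))
    base base-injective base^q

  △-bound : △ (q ℕ.^ 6) ℕ.≥ q ℕ.^ 6 ℕ.* (q ℕ.^ 3 ∸ 1) ℕ.* (q ℕ.+ 1)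
  △-bound = ℕ.≤-trans C.triangles≥ (IsMaxTriangles.upper (△-isMax (q ℕ.^ 6)) G.graph G.admissible)

open import Data.Nat.Base using (_+_; _*_; _^_; _≥_)

theorem1p3 : (q : ℕ) → IsPowerOfOddPrime q → △ (q ^ 6) ≥ q ^ 6 * (q ^ 3 ∸ 1) * (q + 1)
theorem1p3 q (p , suc e , isPrime , 2∤p , _ , ≡.refl) =
  -- `Extension` takes the degree minus one: 2 here for the cubic extension, and `e` below for
  -- degree `suc e` over the prime field.
  △-bound isPrime 2∤p (Extension.fieldExtension isPrime Fq 2) (suc e) ≡.refl
  where
  Fq : FiniteField p (p ^ suc e)
  Fq = FieldExtension.finiteField (Extension.fieldExtension isPrime (IntegersModulo.finiteField isPrime) e)
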